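{- Let the configurations $W_7,W_8,W_9,W_{10},W_{12}\subseteq\{0,1\}^3$ be $W_7=\{(0,0,0),(1,1,1)\}$, $W_8=\{(0,0,1),(0,1,0),(1,0,0)\}$, $W_9=\{(0,0,0),(0,0,1),(0,1,0),(1,1,1)\}$, $W_{10}=\{(0,0,0),(0,0,1),(1,1,1)\}$, $W_{12}=\{(0,0,0),(0,0,1),(0,1,0),(1,0,0)\}$. Then the inducibility constants are $\lambda(W_7)=1/3$, $\lambda(W_8)=2/3$, $\lambda(W_9)=4/9$, $\lambda(W_{10})=5/12$ and $\lambda(W_{12})=1/2$.
   Context: The $n$-hypercube $Q_n$ is the graph on $\{0,1\}^n$ in which two binary sequences are adjacent iff they differ in exactly one coordinate. A $d$-subcube of $\{0,1\}^n$ is a set $C\subseteq\{0,1\}^n$ obtained by fixing $n-d$ coordinates and letting the remaining $d$ coordinates (the flip bits) vary arbitrarily; equivalently the induced subgraph $Q_n[C]$ is isomorphic to $Q_d$. There are $\binom nd 2^{n-d}$ such subcubes. For $H\subseteq\{0,1\}^d$ and $S\subseteq\{0,1\}^n$, a $d$-subcube $C$ gives a copy of $H$ in $S$ if there is a graph isomorphism $f$ from $Q_d$ to $Q_n[C]$ with $f(H)=S\cap C$. Let $\Lambda(H,S)$ be the number of $d$-subcubes giving a copy of $H$ in $S$, let $\Lambda(H,n)=\max\{\Lambda(H,S): S\subseteq\{0,1\}^n\}$ for $n\ge d$, and let the inducibility constant be $\lambda(H)=\lim_{n\to\infty}\Lambda(H,n)/\big(\binom nd 2^{n-d}\big)$ (this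 limit exists since the ratio is non-increasing in $n$). -}

module Defs where

open import Data.Bool using (Bool; true; false; _∧_; _∨_; not; if_then_else_)
open import Data.Nat using (ℕ; zero; suc; _+_; _*_; _∸_; _^_; _≤_; _⊔_)
open import Data.Nat.Combinatorics using (_C_)
open import Data.Integer using (+_)
open import Data.Rational using (ℚ; _/_; _<_; 0ℚ; _-_; ∣_∣)
open import Data.List using (List; []; _∷_; map; concatMap; foldr; length; filter)
open import Data.Bool.ListAction using (all; any)
open import Data.Vec using (Vec; []; _∷_)
open import Data.Maybe using (Maybe; just; nothing)
open import Data.Product using (∃-syntax)
open import Relation.Nullary.Decidable using (does)
open import Data.Nat using (_≡ᵇ_)

Point : ℕ → Set
Point n = Vec Bool n

Config : ℕ → Set
Config n = Point n → Bool

boolEq : Bool → Bool → Bool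
boolEq true  b = b
boolEq false b = not b

eqP : ∀ {n} → Point n → Point n → Bool
eqP []       []       = true
eqP (a ∷ u) (b ∷ v) = boolEq a b ∧ eqP u v

dist : ∀ {n} → Point n → Point n → ℕ
dist []       []       = 0
dist (a ∷ u) (b ∷ v) = (if boolEq a b then 0 else 1) + dist u v

adj : ∀ {n} → Point n → Point n → Bool
adj u v = dist u v ≡ᵇ 1

allPoints : (n : ℕ) → List (Point n)
allPoints zero    = [] ∷ []
allPoints (suc n) = concatMap (λ v → (false ∷ v) ∷ (true ∷ v) ∷ []) (allPoints n)

allFuns : {B : Set} (d : ℕ) → List B → List (Point d → B)
allFuns zero    bs = map (λ b → λ _ → b) bs
allFuns (suc d) bs =
  concatMap (λ f → map (λ g → λ { (false ∷ v) → f v ; (true ∷ v) → g v }) (allFuns d bs))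
            (allFuns d bs)

allConfigs : (n : ℕ) → List (Config n)
allConfigs n = allFuns n (false ∷ true ∷ [])

-- A subcube is described by a pattern: 'just b' = coordinate fixed to b,
-- 'nothing' = flip bit.  A d-subcube has exactly d flip bits.
Pattern : ℕ → Set
Pattern n = Vec (Maybe Bool) n

flips : ∀ {n} → Pattern n → ℕ
flips []            = 0
flips (nothing ∷ c) = suc (flips c)
flips (just _ ∷ c)  = flips c

allPatterns : (n : ℕ) → List (Pattern n)
allPatterns zero    = [] ∷ []
allPatterns (suc n) =
  concatMap (λ c → (nothing ∷ c) ∷ (just false ∷ c) ∷ (just true ∷ c) ∷ []) (allPatterns n)

-- all d-subcubes of {0,1}^n (there are (n choose d) 2^(n-d) of them)
subcubes : (n d : ℕ) → List (Pattern n)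
subcubes n d = filter (λ c → flips c Data.Nat.≟ d) (allPatterns n)

cubePoints : ∀ {n} → Pattern n → List (Point n)
cubePoints []             = [] ∷ []
cubePoints (nothing ∷ c)  = concatMap (λ v → (false ∷ v) ∷ (true ∷ v) ∷ []) (cubePoints c)
cubePoints (just b ∷ c)   = map (b ∷_) (cubePoints c)

member : ∀ {n} → Point n → List (Point n) → Bool
member x = any (eqP x)

-- f : {0,1}^d → C is a graph isomorphism Q_d → Q_n[C]
-- (injective, onto C, and preserving adjacency and non-adjacency)
isIso : ∀ {d n} → Pattern n → (Point d → Point n) → Bool
isIso {d} c f =
  all (λ x → all (λ y → boolEq (eqP x y) (eqP (f x) (f y))
                      ∧ boolEq (adj x y) (adj (f x) (f y))) (allPoints d)) (allPoints d)
  ∧ all (λ p → any (λ x → eqP (f x) p) (allPoints d)) (cubePoints c)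

-- C gives a copy of H in S: some isomorphism f : Q_d → Q_n[C] has f(H) = S ∩ C
-- (f ranges over all maps {0,1}^d → C, checked exhaustively)
givesCopy : ∀ {d n} → Config d → Config n → Pattern n → Bool
givesCopy {d} H S c =
  any (λ f → isIso c f ∧ all (λ x → boolEq (H x) (S (f x))) (allPoints d))
      (allFuns d (cubePoints c))

ΛS : ∀ {d n} → Config d → Config n → ℕ
ΛS {d} {n} H S = length (filter (λ c → givesCopy H S c Data.Bool.≟ true) (subcubes n d))
  where import Data.Bool

Λn : ∀ {d} → Config d → ℕ → ℕ
Λn H n = foldr _⊔_ 0 (map (ΛS H) (allConfigs n))

-- a / b as a rational (b = 0 gives 0; only used with b ≠ 0)
frac : ℕ → ℕ → ℚ
frac a zero    = 0ℚ
frac a (suc b) = (+ a) / suc b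

ratio : ∀ {d} → Config d → ℕ → ℚ
ratio {d} H n = frac (Λn H n) ((n C d) * 2 ^ (n ∸ d))

Inducibility : ∀ {d} → Config d → ℚ → Set
Inducibility {d} H r =
  ∀ (ε : ℚ) → 0ℚ < ε → ∃[ N ] (∀ n → N ≤ n → d ≤ n → ∣ ratio H n - r ∣ < ε)

fromList : ∀ {d} → List (Point d) → Config d
fromList xs x = member x xs

o l : Bool
o = false
l = true

W7 W8 W9 W10 W12 : Config 3
W7  = fromList ((o ∷ o ∷ o ∷ []) ∷ (l ∷ l ∷ l ∷ []) ∷ [])
W8  = fromList ((o ∷ o ∷ l ∷ []) ∷ (o ∷ l ∷ o ∷ []) ∷ (l ∷ o ∷ o ∷ []) ∷ [])
W9  = fromList ((o ∷ o ∷ o ∷ []) ∷ (o ∷ o ∷ l ∷ []) ∷ (o ∷ l ∷ o ∷ []) ∷ (l ∷ l ∷ l ∷ []) ∷ [])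
W10 = fromList ((o ∷ o ∷ o ∷ []) ∷ (o ∷ o ∷ l ∷ []) ∷ (l ∷ l ∷ l ∷ []) ∷ [])
W12 = fromList ((o ∷ o ∷ o ∷ []) ∷ (o ∷ o ∷ l ∷ []) ∷ (o ∷ l ∷ o ∷ []) ∷ (l ∷ o ∷ o ∷ []) ∷ [])

{-# OPTIONS --safe #-}

-- Upper bounds.  For S ⊆ {0,1}ⁿ sum over all points v and all 4-tuples (i, j, k, l) of directions, repetitions
-- allowed; such a tuple always determines a map {0,1}⁴ → {0,1}, x ↦ S(v + x₁eᵢ + x₂eⱼ + x₃eₖ + x₄eₗ).  Expanding
-- Σ_{v,i,j} (Σₖ q(v,i,j;k))² and Σ_v (Σ_{i,j} q(v;i,j))² gives nonnegative sums over these tuples without any error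
-- term.  For suitable q, the number of copies of W among the 3-faces of a 4-cube, plus the squares (symmetrised over the
-- translations and permutations of the 4-cube, which do not change the sum), is bounded pointwise by the right constant;
-- this is a finite check over the subsets of {0,1}⁴.  Dropping the squares bounds the number of pairs (v, ordered triple
-- of directions) spanning a copy by λ(W) n³ 2ⁿ, and each subcube giving a copy accounts for 48 of these pairs.
--
-- Lower bounds.  Let S consist of the x whose state lies in a fixed set, where a coordinate equal to 1 moves the state by
-- the commuting permutation attached to its class.  Averaged over the initial state and over the classes of the
-- coordinates, every 3-subcube is a copy with probability λ(W): for W7 and W8 take weights modulo 3, for W12 weights
-- modulo 4, for W9 steps 1, 1, 2 modulo 4, and for W10 the parities of six classes.  So the ratio is never below λ(W).
module Submission where

open import Defs
open import Data.Bool using (Bool; true; false; not; _∧_; _∨_; _xor_; if_then_else_)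
import Data.Bool as Bool
open import Data.Bool.ListAction using (all; any)
open import Data.Bool.Properties using (T-≡; not-involutive)
open import Data.Empty using (⊥-elim)
open import Data.Fin using (Fin; zero; suc)
open import Data.List using (List; []; _∷_; _++_; allFin; concatMap; filter; foldr; length; map; upTo)
open import Data.List.Membership.Propositional using (_∈_; lose)
open import Data.List.Membership.Propositional.Properties using (∈-map⁺; ∈-map⁻; ∈-concatMap⁺)
open import Data.List.Properties using (concatMap-map; length-tabulate; map-concatMap; map-tabulate; map-∘)
open import Data.List.Relation.Unary.All using (All)
import Data.List.Relation.Unary.All as All
import Data.List.Relation.Unary.All.Properties as All
open import Data.List.Relation.Unary.Any using (here; there)
open import Data.Maybe using (Maybe; just; nothing)
open import Data.Product using (_×_; _,_; proj₁; proj₂; swap; ∃)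
open import Data.Sum using (inj₁; inj₂)
open import Data.Unit using (⊤; tt)
open import Data.Vec using (Vec; []; _∷_; zipWith)
import Data.Vec as Vec
open import Function using (_∘_; id; Equivalence)
open import Relation.Binary.PropositionalEquality using (_≡_; _≢_; refl; sym; trans; cong; cong₂; subst; subst₂; module ≡-Reasoning)
open import Relation.Nullary using (¬_; yes; no)
open import Relation.Nullary.Decidable using (Dec; does)
open import Relation.Unary using (Decidable)

-- From counting bounds to the limit

-- Counting inside single 4-cubes is too weak in general: the middle layer of the 4-cube induces a
-- copy of W8 on all eight of its 3-faces, so without squares the bound would be 1. The squares
-- compare 4-cubes that share a 2-face or a vertex. Since the constructions attain λ(W), every
-- square must be of lower order on near-extremal sets; so its linear form must have mean zero, to
-- leading order, on the constructions, which restricts the forms that can occur. The finite check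
-- is evaluated by the type checker, and this shapes the encoding: contributions are shifted into ℕ,
-- tabulated by the few values they read, and compared only on representatives modulo translation.
-- Allowing repeated directions costs only the factor n³ / (n(n - 1)(n - 2)), hence a relative error
-- of at most 12/n in the upper bound.

module Limit where

  open import Data.Nat
  open import Data.Nat.Properties
  open import Data.Nat.Combinatorics using (_C_; nC1≡n; nCk+nC[k+1]≡[n+1]C[k+1])
  open import Data.Nat.Solver using (module +-*-Solver)
  import Data.Integer as ℤ
  import Data.Integer.Properties as ℤ
  open import Data.Rational using (ℚ; mkℚ; 0ℚ; ↧ₙ_; toℚᵘ)
  import Data.Rational as ℚ
  import Data.Rational.Properties as ℚ
  open import Data.Rational.Unnormalised using (mkℚᵘ; _≃_; *<*)
  import Data.Rational.Unnormalised as ℚᵘ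
  import Data.Rational.Unnormalised.Properties as ℚᵘ

  nC2-formula : ∀ n → 2 * (suc n C 2) ≡ suc n * n
  nC2-formula zero    = refl
  nC2-formula (suc n) = begin
    2 * (suc (suc n) C 2)              ≡⟨ cong (2 *_) (sym (nCk+nC[k+1]≡[n+1]C[k+1] (suc n) 1)) ⟩
    2 * (suc n C 1 + suc n C 2)        ≡⟨ *-distribˡ-+ 2 (suc n C 1) (suc n C 2) ⟩
    2 * (suc n C 1) + 2 * (suc n C 2)  ≡⟨ cong₂ (λ x y → 2 * x + y) (nC1≡n (suc n)) (nC2-formula n) ⟩
    2 * suc n + suc n * n              ≡⟨ solve 1 (λ n → con 2 :* (con 1 :+ n) :+ (con 1 :+ n) :* n := (con 2 :+ n) :* (con 1 :+ n)) refl n ⟩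
    suc (suc n) * suc n                ∎
    where
    open ≡-Reasoning
    open +-*-Solver

  nC3-formula : ∀ n → 6 * (suc (suc n) C 3) ≡ suc (suc n) * (suc n * n)
  nC3-formula zero    = refl
  nC3-formula (suc n) = begin
    6 * (suc (suc (suc n)) C 3)                          ≡⟨ cong (6 *_) (sym (nCk+nC[k+1]≡[n+1]C[k+1] (suc (suc n)) 2)) ⟩
    6 * (suc (suc n) C 2 + suc (suc n) C 3)              ≡⟨ solve 2 (λ x y → con 6 :* (x :+ y) := con 3 :* (con 2 :* x) :+ con 6 :* y) refl (suc (suc n) C 2) (suc (suc n) C 3) ⟩
    3 * (2 * (suc (suc n) C 2)) + 6 * (suc (suc n) C 3)  ≡⟨ cong₂ (λ x y → 3 * x + y) (nC2-formula (suc n)) (nC3-formula n) ⟩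
    3 * (suc (suc n) * suc n) + suc (suc n) * (suc n * n)
      ≡⟨ solve 1 (λ n → con 3 :* ((con 2 :+ n) :* (con 1 :+ n)) :+ (con 2 :+ n) :* ((con 1 :+ n) :* n)
                      := (con 3 :+ n) :* ((con 2 :+ n) :* (con 1 :+ n))) refl n ⟩
    suc (suc (suc n)) * (suc (suc n) * suc n)            ∎
    where
    open ≡-Reasoning
    open +-*-Solver

  subcubeCount : ℕ → ℕ
  subcubeCount n = (n C 3) * 2 ^ (n ∸ 3)

  48*subcubeCount : ∀ m → 48 * subcubeCount (3 + m) ≡ 2 ^ (3 + m) * ((3 + m) * ((2 + m) * (1 + m)))
  48*subcubeCount m = begin
    48 * (((3 + m) C 3) * 2 ^ m)                    ≡⟨ solve 2 (λ x y → con 48 :* (x :* y) := (con 8 :* y) :* (con 6 :* x)) refl ((3 + m) C 3) (2 ^ m) ⟩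
    (8 * 2 ^ m) * (6 * ((3 + m) C 3))               ≡⟨ cong₂ _*_ (solve 1 (λ y → con 8 :* y := con 2 :* (con 2 :* (con 2 :* y))) refl (2 ^ m)) (nC3-formula (suc m)) ⟩
    2 ^ (3 + m) * ((3 + m) * ((2 + m) * (1 + m)))   ∎
    where
    open ≡-Reasoning
    open +-*-Solver

  subcubeCount>0 : ∀ m → 0 < subcubeCount (3 + m)
  subcubeCount>0 m with subcubeCount (3 + m) in e
  ... | suc _ = s≤s z≤n
  ... | zero  = ⊥-elim (<-irrefl (trans (cong (48 *_) (sym e)) (48*subcubeCount m))
                  (*-mono-≤ (m^n>0 2 (3 + m)) (s≤s z≤n)))

  -- n³ ≤ (n + 12)(n − 1)(n − 2) for n = 3 + m turns the bound on ordered triples into one on subcubes.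
  relative : ∀ p q L m → q * (48 * L) ≤ p * (2 ^ (3 + m) * ((3 + m) * ((3 + m) * (3 + m)))) →
             (3 + m) * (q * L) ≤ (15 + m) * (p * subcubeCount (3 + m))
  relative p q L m h = *-cancelˡ-≤ (48 * ((2 + m) * (1 + m))) (begin
    (48 * ((2 + m) * (1 + m))) * ((3 + m) * (q * L))
      ≡⟨ solve 3 (λ m q L → (con 48 :* ((con 2 :+ m) :* (con 1 :+ m))) :* ((con 3 :+ m) :* (q :* L))
           := ((con 3 :+ m) :* ((con 2 :+ m) :* (con 1 :+ m))) :* (q :* (con 48 :* L))) refl m q L ⟩
    ((3 + m) * ((2 + m) * (1 + m))) * (q * (48 * L))
      ≤⟨ *-monoʳ-≤ ((3 + m) * ((2 + m) * (1 + m))) h ⟩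
    ((3 + m) * ((2 + m) * (1 + m))) * (p * (P * ((3 + m) * ((3 + m) * (3 + m)))))
      ≡⟨ solve 3 (λ m p P → ((con 3 :+ m) :* ((con 2 :+ m) :* (con 1 :+ m))) :* (p :* (P :* ((con 3 :+ m) :* ((con 3 :+ m) :* (con 3 :+ m)))))
           := (p :* (P :* ((con 3 :+ m) :* ((con 2 :+ m) :* (con 1 :+ m))))) :* ((con 3 :+ m) :* ((con 3 :+ m) :* (con 3 :+ m)))) refl m p P ⟩
    (p * (P * ((3 + m) * ((2 + m) * (1 + m))))) * ((3 + m) * ((3 + m) * (3 + m)))
      ≤⟨ *-monoʳ-≤ (p * (P * ((3 + m) * ((2 + m) * (1 + m))))) cubic ⟩
    (p * (P * ((3 + m) * ((2 + m) * (1 + m))))) * ((15 + m) * ((2 + m) * (1 + m)))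
      ≡⟨ cong (λ x → (p * x) * ((15 + m) * ((2 + m) * (1 + m)))) (sym (48*subcubeCount m)) ⟩
    (p * (48 * subcubeCount (3 + m))) * ((15 + m) * ((2 + m) * (1 + m)))
      ≡⟨ solve 3 (λ m p N → (p :* (con 48 :* N)) :* ((con 15 :+ m) :* ((con 2 :+ m) :* (con 1 :+ m)))
           := (con 48 :* ((con 2 :+ m) :* (con 1 :+ m))) :* ((con 15 :+ m) :* (p :* N))) refl m p (subcubeCount (3 + m)) ⟩
    (48 * ((2 + m) * (1 + m))) * ((15 + m) * (p * subcubeCount (3 + m))) ∎)
    where
    open ≤-Reasoning
    open +-*-Solver
    P = 2 ^ (3 + m)
    cubic : (3 + m) * ((3 + m) * (3 + m)) ≤ (15 + m) * ((2 + m) * (1 + m))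
    cubic = subst ((3 + m) * ((3 + m) * (3 + m)) ≤_)
      (solve 1 (λ m → (con 3 :+ m) :* ((con 3 :+ m) :* (con 3 :+ m)) :+ (con 9 :* (m :* m) :+ con 20 :* m :+ con 3)
        := (con 15 :+ m) :* ((con 2 :+ m) :* (con 1 :+ m))) refl m)
      (m≤m+n ((3 + m) * ((3 + m) * (3 + m))) (9 * (m * m) + 20 * m + 3))

  toℚᵘ-frac : ∀ a b → toℚᵘ (frac a (suc b)) ≃ mkℚᵘ (ℤ.+ a) b
  toℚᵘ-frac a b = ℚ.toℚᵘ-fromℚᵘ (mkℚᵘ (ℤ.+ a) b)

  -- The difference is `t / (suc N * suc q)`. The two bounds give `n * t ≤ 12 * (p * suc N)`, and
  -- `p ≤ suc q` turns this into an error of at most 12/n. A positive ε is at least the reciprocal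
  -- of its denominator, so `n` beyond 12 denominators suffices.
  close : ∀ L N p q n (ε : ℚ) → 0ℚ ℚ.< ε → p ≤ suc q → p * suc N ≤ suc q * L → n * (suc q * L) ≤ (12 + n) * (p * suc N) →
          12 * ↧ₙ ε < n → ℚ.∣ frac L (suc N) ℚ.- frac p (suc q) ∣ ℚ.< ε
  close L N p q n (mkℚ (ℤ.+ zero) d c) (ℚ.*<* (ℤ.+<+ ())) _ _ _ _
  close L N p q n (mkℚ ℤ.-[1+ a ] d c) (ℚ.*<* ()) _ _ _ _
  close L N p q n ε@(mkℚ (ℤ.+ suc a) d c) 0<ε p≤q low up large = ℚ.toℚᵘ-cancel-< (ℚᵘ.<-respˡ-≃ (ℚᵘ.≃-sym unnormalised) (*<* (subst₂ ℤ._<_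
      (trans (ℤ.pos-* t (suc d)) (cong (λ z → ℤ.+ z ℤ.* ℤ.+ suc d) (sym numerator))) (ℤ.pos-* (suc a) (suc N * suc q)) (ℤ.+<+ small))))
    where
    t = suc q * L ∸ p * suc N
    split : p * suc N + t ≡ suc q * L
    split = m+[n∸m]≡n low
    unnormalised : toℚᵘ (ℚ.∣ frac L (suc N) ℚ.- frac p (suc q) ∣) ≃ ℚᵘ.∣ mkℚᵘ (ℤ.+ L) N ℚᵘ.- mkℚᵘ (ℤ.+ p) q ∣
    unnormalised = ℚᵘ.≃-trans (ℚ.toℚᵘ-homo-∣-∣ (frac L (suc N) ℚ.- frac p (suc q))) (ℚᵘ.∣-∣-cong
      (ℚᵘ.≃-trans (ℚ.toℚᵘ-homo-+ (frac L (suc N)) (ℚ.- frac p (suc q))) (ℚᵘ.+-cong (toℚᵘ-frac L N)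
        (ℚᵘ.≃-trans (ℚ.toℚᵘ-homo‿- (frac p (suc q))) (ℚᵘ.-‿cong (toℚᵘ-frac p q))))))
    numerator : ℤ.∣ ℤ.+ L ℤ.* ℤ.+ suc q ℤ.+ ℤ.- (ℤ.+ p) ℤ.* ℤ.+ suc N ∣ ≡ t
    numerator = trans (cong ℤ.∣_∣ (begin
      ℤ.+ L ℤ.* ℤ.+ suc q ℤ.+ ℤ.- (ℤ.+ p) ℤ.* ℤ.+ suc N    ≡⟨ cong₂ ℤ._+_ (trans (ℤ.*-comm (ℤ.+ L) (ℤ.+ suc q)) (sym (ℤ.pos-* (suc q) L))) (trans (sym (ℤ.neg-distribˡ-* (ℤ.+ p) (ℤ.+ suc N))) (cong ℤ.-_ (sym (ℤ.pos-* p (suc N))))) ⟩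
      ℤ.+ (suc q * L) ℤ.- ℤ.+ (p * suc N)                  ≡⟨ ℤ.m-n≡m⊖n (suc q * L) (p * suc N) ⟩
      (suc q * L) ℤ.⊖ (p * suc N)                          ≡⟨ ℤ.⊖-≥ low ⟩
      ℤ.+ t                                                ∎)) refl
      where open ≡-Reasoning
    12pN≥ : n * t ≤ 12 * (p * suc N)
    12pN≥ = +-cancelˡ-≤ (n * (p * suc N)) (n * t) (12 * (p * suc N)) (begin
      n * (p * suc N) + n * t         ≡⟨ sym (*-distribˡ-+ n (p * suc N) t) ⟩
      n * (p * suc N + t)             ≡⟨ cong (n *_) split ⟩
      n * (suc q * L)                 ≤⟨ up ⟩
      (12 + n) * (p * suc N)          ≡⟨ *-distribʳ-+ (p * suc N) 12 n ⟩
      12 * (p * suc N) + n * (p * suc N) ≡⟨ +-comm (12 * (p * suc N)) (n * (p * suc N)) ⟩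
      n * (p * suc N) + 12 * (p * suc N) ∎)
      where open ≤-Reasoning
    small : t * suc d < suc a * (suc N * suc q)
    small = *-cancelˡ-< n (t * suc d) (suc a * (suc N * suc q)) (begin-strict
      n * (t * suc d)                     ≡⟨ sym (*-assoc n t (suc d)) ⟩
      (n * t) * suc d                     ≤⟨ *-monoˡ-≤ (suc d) 12pN≥ ⟩
      (12 * (p * suc N)) * suc d          ≤⟨ *-monoˡ-≤ (suc d) (*-monoʳ-≤ 12 (*-monoˡ-≤ (suc N) p≤q)) ⟩
      (12 * (suc q * suc N)) * suc d      ≡⟨ solve 3 (λ q N d → (con 12 :* (q :* N)) :* d := (con 12 :* d) :* (N :* q)) refl (suc q) (suc N) (suc d) ⟩
      (12 * suc d) * (suc N * suc q)      <⟨ *-monoˡ-< (suc N * suc q) large ⟩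
      n * (suc N * suc q)                 ≤⟨ *-monoʳ-≤ n (m≤n*m (suc N * suc q) (suc a)) ⟩
      n * (suc a * (suc N * suc q))       ∎)
      where
      open ≤-Reasoning
      open +-*-Solver

  inducibility : (H : Config 3) (p q : ℕ) → p ≤ suc q → (∀ n → p * subcubeCount n ≤ suc q * Λn H n) →
    (∀ m → suc q * (48 * Λn H (suc m)) ≤ p * (2 ^ suc m * (suc m * (suc m * suc m)))) → Inducibility H (frac p (suc q))
  inducibility H p q p≤q low up ε 0<ε = suc (12 * ↧ₙ ε) , λ { (suc (suc (suc m))) large (s≤s (s≤s (s≤s _))) → bound m large }
    where
    bound : ∀ m → 12 * ↧ₙ ε < 3 + m → ℚ.∣ ratio H (3 + m) ℚ.- frac p (suc q) ∣ ℚ.< ε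
    -- `frac` computes only on a successor, so the subcube count is generalised to a positive `N`.
    bound m large = go (subcubeCount (3 + m)) refl (subcubeCount>0 m)
      where
      go : ∀ N → N ≡ subcubeCount (3 + m) → 0 < N → ℚ.∣ ratio H (3 + m) ℚ.- frac p (suc q) ∣ ℚ.< ε
      go (suc N) e _ = subst (λ N → ℚ.∣ frac (Λn H (3 + m)) N ℚ.- frac p (suc q) ∣ ℚ.< ε) e
        (close (Λn H (3 + m)) N p q (3 + m) ε 0<ε p≤q (subst (λ N → p * N ≤ suc q * Λn H (3 + m)) (sym e) (low (3 + m)))
          (subst (λ N → (3 + m) * (suc q * Λn H (3 + m)) ≤ (15 + m) * (p * N)) (sym e) (relative p (suc q) (Λn H (3 + m)) m (up (2 + m)))) large)

open Limit using (subcubeCount; inducibility)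

open import Data.Nat using (ℕ; zero; suc; _≡ᵇ_; _≤ᵇ_; _<ᵇ_)
import Data.Nat as ℕ
import Data.Nat.Properties as ℕ
open import Data.Nat.Combinatorics using (_C_; nCn≡1; nCk≡nC[n∸k]; k>n⇒nCk≡0; nCk+nC[k+1]≡[n+1]C[k+1])
open import Data.Integer using (ℤ; +_; -[1+_]; _+_; _*_; -_; _≤_; 0ℤ; 1ℤ; -1ℤ; ∣_∣; +≤+; -≤+; Positive)
open import Data.Integer.Properties
open import Data.Integer.Solver using (module +-*-Solver)
open import Algebra.Properties.CommutativeSemigroup +-commutativeSemigroup using (interchange)

private variable
  A B X Y : Set
  n : ℕ

-- Sums over points and directions

0≤square : ∀ i → 0ℤ ≤ i * i
0≤square (+ m)    = subst (0ℤ ≤_) (pos-* m m) (+≤+ ℕ.z≤n)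
0≤square -[1+ m ] = +≤+ ℕ.z≤n

opaque
  -- Opaque, so that conversion checking treats sums as atoms and only the lemmas of this block
  -- unfold them.
  ∑ : List X → (X → ℤ) → ℤ
  ∑ []       f = 0ℤ
  ∑ (x ∷ xs) f = f x + ∑ xs f

  ∑-cong : (xs : List X) {f g : X → ℤ} → (∀ x → f x ≡ g x) → ∑ xs f ≡ ∑ xs g
  ∑-cong []       e = refl
  ∑-cong (x ∷ xs) e = cong₂ _+_ (e x) (∑-cong xs e)

  ∑-mono : (xs : List X) {f g : X → ℤ} → (∀ x → f x ≤ g x) → ∑ xs f ≤ ∑ xs g
  ∑-mono []       e = ≤-refl
  ∑-mono (x ∷ xs) e = +-mono-≤ (e x) (∑-mono xs e)

  ∑-+ : (xs : List X) (f g : X → ℤ) → ∑ xs (λ x → f x + g x) ≡ ∑ xs f + ∑ xs g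
  ∑-+ []       f g = refl
  ∑-+ (x ∷ xs) f g = trans (cong (_+_ ((f x + g x))) (∑-+ xs f g)) (interchange (f x) (g x) _ _)

  ∑-*ˡ : (xs : List X) (c : ℤ) (f : X → ℤ) → ∑ xs (λ x → c * f x) ≡ c * ∑ xs f
  ∑-*ˡ []       c f = sym (*-zeroʳ c)
  ∑-*ˡ (x ∷ xs) c f = trans (cong (_+_ (c * f x)) (∑-*ˡ xs c f)) (sym (*-distribˡ-+ c (f x) _))

  ∑-*ʳ : (xs : List X) (c : ℤ) (f : X → ℤ) → ∑ xs (λ x → f x * c) ≡ ∑ xs f * c
  ∑-*ʳ xs c f = trans (∑-cong xs (λ x → *-comm (f x) c)) (trans (∑-*ˡ xs c f) (*-comm c _))

  ∑-zero : (xs : List X) → ∑ xs (λ _ → 0ℤ) ≡ 0ℤ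
  ∑-zero []       = refl
  ∑-zero (x ∷ xs) = trans (+-identityˡ _) (∑-zero xs)

  ∑-swap : (xs : List X) (ys : List Y) (f : X → Y → ℤ) →
           ∑ xs (λ x → ∑ ys (f x)) ≡ ∑ ys (λ y → ∑ xs (λ x → f x y))
  ∑-swap []       ys f = sym (∑-zero ys)
  ∑-swap (x ∷ xs) ys f = trans (cong (_+_ (∑ ys (f x))) (∑-swap xs ys f)) (sym (∑-+ ys (f x) _))

  ∑-const : (xs : List X) (c : ℤ) → ∑ xs (λ _ → c) ≡ + length xs * c
  ∑-const []       c = sym (*-zeroˡ c)
  ∑-const (x ∷ xs) c = trans (cong (_+ ∑ xs (λ _ → c)) (sym (*-identityˡ c)))
    (trans (cong (_+_ (1ℤ * c)) (∑-const xs c)) (sym (*-distribʳ-+ c 1ℤ (+ length xs))))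

  ∑-++ : (xs ys : List X) (f : X → ℤ) → ∑ (xs ++ ys) f ≡ ∑ xs f + ∑ ys f
  ∑-++ []       ys f = sym (+-identityˡ _)
  ∑-++ (x ∷ xs) ys f = trans (cong (_+_ (f x)) (∑-++ xs ys f)) (sym (+-assoc (f x) _ _))

  ∑-map : (g : X → Y) (xs : List X) (f : Y → ℤ) → ∑ (map g xs) f ≡ ∑ xs (f ∘ g)
  ∑-map g []       f = refl
  ∑-map g (x ∷ xs) f = cong (_+_ (f (g x))) (∑-map g xs f)

  ∑-concatMap : (g : X → List Y) (xs : List X) (f : Y → ℤ) →
                ∑ (concatMap g xs) f ≡ ∑ xs (λ x → ∑ (g x) f)
  ∑-concatMap g []       f = refl
  ∑-concatMap g (x ∷ xs) f = trans (∑-++ (g x) (concatMap g xs) f) (cong (_+_ (∑ (g x) f)) (∑-concatMap g xs f))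

  ∑-square : (xs : List X) (f : X → ℤ) → ∑ xs (λ x → ∑ xs (λ y → f x * f y)) ≡ ∑ xs f * ∑ xs f
  ∑-square xs f = trans (∑-cong xs (λ x → ∑-*ˡ xs (f x) f)) (∑-*ʳ xs (∑ xs f) f)

  ∑-nonneg : (xs : List X) {f : X → ℤ} → (∀ x → 0ℤ ≤ f x) → 0ℤ ≤ ∑ xs f
  ∑-nonneg xs h = subst (_≤ ∑ xs _) (∑-zero xs) (∑-mono xs h)

  ∑-[] : (f : X → ℤ) → ∑ [] f ≡ 0ℤ
  ∑-[] f = refl

  ∑-∷ : (x : X) (xs : List X) (f : X → ℤ) → ∑ (x ∷ xs) f ≡ f x + ∑ xs f
  ∑-∷ x xs f = refl

  ∑-pair : (x y : X) (f : X → ℤ) → ∑ (x ∷ y ∷ []) f ≡ f x + f y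
  ∑-pair x y f = cong (_+_ (f x)) (+-identityʳ (f y))

∑-allPoints : ∀ n (f : Point (suc n) → ℤ) →
  ∑ (allPoints (suc n)) f ≡ ∑ (allPoints n) (λ v → f (false ∷ v) + f (true ∷ v))
∑-allPoints n f = trans (∑-concatMap _ (allPoints n) f)
  (∑-cong (allPoints n) (λ v → ∑-pair (false ∷ v) (true ∷ v) f))

flip : Fin n → Point n → Point n
flip zero    (b ∷ v) = not b ∷ v
flip (suc i) (b ∷ v) = b ∷ flip i v

flip-involutive : (i : Fin n) (v : Point n) → flip i (flip i v) ≡ v
flip-involutive zero    (b ∷ v) = cong (_∷ v) (not-involutive b)
flip-involutive (suc i) (b ∷ v) = cong (b ∷_) (flip-involutive i v)

flip-comm : (i j : Fin n) (v : Point n) → flip i (flip j v) ≡ flip j (flip i v)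
flip-comm zero    zero    (b ∷ v) = refl
flip-comm zero    (suc j) (b ∷ v) = refl
flip-comm (suc i) zero    (b ∷ v) = refl
flip-comm (suc i) (suc j) (b ∷ v) = cong (b ∷_) (flip-comm i j v)

∑-flip : (i : Fin n) (f : Point n → ℤ) → ∑ (allPoints n) (f ∘ flip i) ≡ ∑ (allPoints n) f
∑-flip {suc n} zero f = trans (∑-allPoints n (f ∘ flip zero))
  (trans (∑-cong (allPoints n) (λ v → +-comm (f (true ∷ v)) (f (false ∷ v)))) (sym (∑-allPoints n f)))
∑-flip {suc n} (suc i) f = trans (∑-allPoints n (f ∘ flip (suc i)))
  (trans (∑-flip i (λ v → f (false ∷ v) + f (true ∷ v))) (sym (∑-allPoints n f)))

-- Cubes of values: the innermost pair corresponds to the first direction.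

Cube : Set → ℕ → Set
Cube A zero    = A
Cube A (suc k) = Cube (A × A) k

double : (Point n → A) → Fin n → Point n → A × A
double S i v = S v , S (flip i v)

map₂ : (A → B) → A × A → B × B
map₂ f (x , y) = f x , f y

transpose : (A × A) × (A × A) → (A × A) × (A × A)
transpose ((a , b) , (c , d)) = (a , c) , (b , d)

double-flip : (S : Point n → A) (i : Fin n) → ∀ v → double S i (flip i v) ≡ swap (double S i v)
double-flip S i v = cong (S (flip i v) ,_) (cong S (flip-involutive i v))

double-flip-map₂ : (S : Point n → A) (σ : A → A) (i : Fin n) → (∀ v → S (flip i v) ≡ σ (S v)) →
                   ∀ j v → double S j (flip i v) ≡ map₂ σ (double S j v)
double-flip-map₂ S σ i h j v = cong₂ _,_ (h v) (trans (cong S (flip-comm j i v)) (h (flip j v)))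

double-map₂ : (S S′ : Point n → A) (σ : A → A) → (∀ v → S′ v ≡ σ (S v)) →
              ∀ i v → double S′ i v ≡ map₂ σ (double S i v)
double-map₂ S S′ σ h i v = cong₂ _,_ (h v) (h (flip i v))

double-transpose : (S : Point n → A) (i j : Fin n) → ∀ v →
                   double (double S j) i v ≡ transpose (double (double S i) j v)
double-transpose S i j v = cong (λ x → (S v , S (flip j v)) , (S (flip i v) , x)) (cong S (flip-comm j i v))

Cube₂ Cube₃ Cube₄ : Set
Cube₂ = Cube Bool 2
Cube₃ = Cube Bool 3
Cube₄ = Cube Bool 4

t₁ t₂ t₃ t₄ s₁₂ s₂₃ s₃₄ : Cube₄ → Cube₄
t₁  = map₂ (map₂ (map₂ swap))
t₂  = map₂ (map₂ swap)
t₃  = map₂ swap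
t₄  = swap
s₁₂ = map₂ (map₂ transpose)
s₂₃ = map₂ transpose
s₃₄ = transpose

module Averages {n : ℕ} (S : Config n) where

  Ds : List (Fin n)
  Ds = allFin n

  cube₂ : Fin n → Fin n → Point n → Cube₂
  cube₂ i j = double (double S i) j

  cube₃ : Fin n → Fin n → Fin n → Point n → Cube₃
  cube₃ i j k = double (cube₂ i j) k

  cube₄ : Fin n → Fin n → Fin n → Fin n → Point n → Cube₄
  cube₄ i j k l = double (cube₃ i j k) l

  E : (Cube₄ → ℤ) → ℤ
  E h = ∑ (allPoints n) λ v → ∑ Ds λ i → ∑ Ds λ j → ∑ Ds λ k → ∑ Ds λ l → h (cube₄ i j k l v)

  E-cong : {g h : Cube₄ → ℤ} → (∀ c → g c ≡ h c) → E g ≡ E h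
  E-cong e = ∑-cong _ λ v → ∑-cong Ds λ i → ∑-cong Ds λ j → ∑-cong Ds λ k → ∑-cong Ds λ l → e _

  E-mono : {g h : Cube₄ → ℤ} → (∀ c → g c ≤ h c) → E g ≤ E h
  E-mono e = ∑-mono _ λ v → ∑-mono Ds λ i → ∑-mono Ds λ j → ∑-mono Ds λ k → ∑-mono Ds λ l → e _

  ∑⁴ : (Fin n → Fin n → Fin n → Fin n → ℤ) → ℤ
  ∑⁴ f = ∑ Ds λ i → ∑ Ds λ j → ∑ Ds λ k → ∑ Ds λ l → f i j k l

  ∑⁴-cong : {f g : Fin n → Fin n → Fin n → Fin n → ℤ} → (∀ i j k l → f i j k l ≡ g i j k l) → ∑⁴ f ≡ ∑⁴ g
  ∑⁴-cong e = ∑-cong Ds λ i → ∑-cong Ds λ j → ∑-cong Ds λ k → ∑-cong Ds λ l → e i j k l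

  E≡ : ∀ h → E h ≡ ∑⁴ λ i j k l → ∑ (allPoints n) λ v → h (cube₄ i j k l v)
  E≡ h = trans (∑-swap _ Ds _) (∑-cong Ds λ i → trans (∑-swap _ Ds _) (∑-cong Ds λ j →
         trans (∑-swap _ Ds _) (∑-cong Ds λ k → ∑-swap _ Ds _)))

  Symmetry : (Cube₄ → Cube₄) → Set
  Symmetry σ = ∀ h → E (h ∘ σ) ≡ E h

  -- A translation of the cube is absorbed by moving the base point.
  translation : (σ : Cube₄ → Cube₄) (m : Fin n → Fin n → Fin n → Fin n → Fin n) →
      (∀ i j k l v → cube₄ i j k l (flip (m i j k l) v) ≡ σ (cube₄ i j k l v)) → Symmetry σ
  translation σ m e h = trans (E≡ (h ∘ σ)) (trans (∑⁴-cong λ i j k l →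
    trans (∑-cong _ λ v → cong h (sym (e i j k l v))) (∑-flip (m i j k l) _)) (sym (E≡ h)))

  t₁-symmetry : Symmetry t₁
  t₁-symmetry = translation t₁ (λ i j k l → i) λ i j k l →
    double-flip-map₂ (cube₃ i j k) (map₂ (map₂ swap)) i (double-flip-map₂ (cube₂ i j) (map₂ swap) i
      (double-flip-map₂ (double S i) swap i (double-flip S i) j) k) l

  t₂-symmetry : Symmetry t₂
  t₂-symmetry = translation t₂ (λ i j k l → j) λ i j k l →
    double-flip-map₂ (cube₃ i j k) (map₂ swap) j (double-flip-map₂ (cube₂ i j) swap j (double-flip (double S i) j) k) l

  t₃-symmetry : Symmetry t₃
  t₃-symmetry = translation t₃ (λ i j k l → k) λ i j k l →
    double-flip-map₂ (cube₃ i j k) swap k (double-flip (cube₂ i j) k) l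

  t₄-symmetry : Symmetry t₄
  t₄-symmetry = translation t₄ (λ i j k l → l) λ i j k l → double-flip (cube₃ i j k) l

  s₁₂-symmetry : Symmetry s₁₂
  s₁₂-symmetry h = ∑-cong _ λ v → trans (∑-swap Ds Ds _)
    (∑-cong Ds λ j → ∑-cong Ds λ i → ∑-cong Ds λ k → ∑-cong Ds λ l →
      cong h (sym (double-map₂ (cube₃ i j k) (cube₃ j i k) (map₂ transpose)
        (double-map₂ (cube₂ i j) (cube₂ j i) transpose (double-transpose S i j) k) l v)))

  s₂₃-symmetry : Symmetry s₂₃
  s₂₃-symmetry h = ∑-cong _ λ v → ∑-cong Ds λ i → trans (∑-swap Ds Ds _)
    (∑-cong Ds λ k → ∑-cong Ds λ j → ∑-cong Ds λ l →
      cong h (sym (double-map₂ (cube₃ i j k) (cube₃ i k j) transpose (double-transpose (double S i) j k) l v)))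

  s₃₄-symmetry : Symmetry s₃₄
  s₃₄-symmetry h = ∑-cong _ λ v → ∑-cong Ds λ i → ∑-cong Ds λ j → trans (∑-swap Ds Ds _)
    (∑-cong Ds λ l → ∑-cong Ds λ k →
      cong h (sym (double-transpose (cube₂ i j) k l v)))

  E-+ : ∀ g h → E (λ c → g c + h c) ≡ E g + E h
  E-+ g h = trans (∑-cong _ λ v → trans (∑-cong Ds λ i → trans (∑-cong Ds λ j → trans (∑-cong Ds λ k →
      ∑-+ Ds _ _) (∑-+ Ds _ _)) (∑-+ Ds _ _)) (∑-+ Ds _ _)) (∑-+ (allPoints n) _ _)

  E-*ˡ : ∀ a h → E (λ c → a * h c) ≡ a * E h
  E-*ˡ a h = trans (∑-cong _ λ v → trans (∑-cong Ds λ i → trans (∑-cong Ds λ j → trans (∑-cong Ds λ k →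
      ∑-*ˡ Ds a _) (∑-*ˡ Ds a _)) (∑-*ˡ Ds a _)) (∑-*ˡ Ds a _)) (∑-*ˡ (allPoints n) a _)

-- Quadratic forms in 2-face statistics and their symmetrisation over the 4-cube

bit : Bool → ℕ
bit false = 0
bit true  = 1

code : Cube₂ → ℕ
code ((a , b) , (c , d)) = bit a ℕ.+ 2 ℕ.* bit b ℕ.+ 4 ℕ.* bit c ℕ.+ 8 ℕ.* bit d

-- Entries are indexed by the codes of face configurations; those not listed are zero.
Vector : Set
Vector = List (ℕ × ℤ)

entry : Vector → ℕ → ℤ
entry []             m = 0ℤ
entry ((k , z) ∷ q)  m = if k ≡ᵇ m then z else entry q m

-- (w , q) stands for the quadratic form w q².
Form : Set
Form = List (ℕ × Vector)

eval : Form → ℕ → ℕ → ℤ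
eval []            x y = 0ℤ
eval ((w , q) ∷ Q) x y = + w * (entry q x * entry q y) + eval Q x y

-- Each entry factors: the double sum of `w q(x) q(y)` is `w` times the square of the single sum of
-- `q`.
∑∑-eval-nonneg : (Q : Form) (xs : List X) (f : X → ℕ) → 0ℤ ≤ ∑ xs λ x → ∑ xs λ y → eval Q (f x) (f y)
∑∑-eval-nonneg []            xs f = ∑-nonneg xs λ x → ∑-nonneg xs λ y → ≤-refl
∑∑-eval-nonneg ((w , q) ∷ Q) xs f = subst (0ℤ ≤_) (sym split) (+-mono-≤ nonneg (∑∑-eval-nonneg Q xs f))
  where
  g = λ x → entry q (f x)
  split : ∑ xs (λ x → ∑ xs λ y → eval ((w , q) ∷ Q) (f x) (f y))
        ≡ + w * (∑ xs g * ∑ xs g) + ∑ xs (λ x → ∑ xs λ y → eval Q (f x) (f y))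
  split = trans (∑-cong xs λ x → ∑-+ xs _ _) (trans (∑-+ xs _ _)
    (cong (_+ ∑ xs (λ x → ∑ xs λ y → eval Q (f x) (f y)))
      (trans (∑-cong xs λ x → ∑-*ˡ xs (+ w) _) (trans (∑-*ˡ xs (+ w) _) (cong (+ w *_) (∑-square xs g))))))
  nonneg : 0ℤ ≤ + w * (∑ xs g * ∑ xs g)
  nonneg = subst (_≤ + w * (∑ xs g * ∑ xs g)) (*-zeroʳ (+ w)) (*-monoˡ-≤-nonNeg (+ w) (0≤square (∑ xs g)))

pairs : List X → List (X × X)
pairs xs = concatMap (λ x → map (x ,_) xs) xs

∑-pairs : (xs : List X) (f : X → X → ℤ) → ∑ (pairs xs) (λ p → f (proj₁ p) (proj₂ p)) ≡ ∑ xs λ x → ∑ xs (f x)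
∑-pairs xs f = trans (∑-concatMap _ xs _) (∑-cong xs λ x → ∑-map (x ,_) xs _)

-- The operation is a parameter because every symmetrisation is needed twice: over ℤ in the proof
-- and over ℕ in the evaluated check.
symm : (X → X → X) → (Cube₄ → Cube₄) → (Cube₄ → X) → Cube₄ → X
symm _∙_ σ h c = h c ∙ h (σ c)

translates : (X → X → X) → (Cube₄ → X) → Cube₄ → X
translates _∙_ h = symm _∙_ t₃ (symm _∙_ t₄ (symm _∙_ t₁ (symm _∙_ t₂ h)))

-- Sums over the six choices of the first two directions, the three perfect matchings of the directions and the four
-- choices of the first three directions.
faces matchings facets : (X → X → X) → (Cube₄ → X) → Cube₄ → X
faces _∙_ h c = (h c ∙ (h (s₂₃ c) ∙ h (s₂₃ (s₁₂ c)))) ∙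
                (h (s₂₃ (s₃₄ c)) ∙ (h (s₂₃ (s₃₄ (s₁₂ c))) ∙ h (s₂₃ (s₁₂ (s₃₄ (s₂₃ c))))))
matchings _∙_ h c = h c ∙ (h (s₂₃ c) ∙ h (s₂₃ (s₃₄ c)))
facets _∙_ h c = (h c ∙ h (s₃₄ c)) ∙ (h (s₃₄ (s₂₃ c)) ∙ h (s₃₄ (s₂₃ (s₁₂ c))))

record Invariant (h : Cube₄ → X) : Set where
  field
    inv₁ : ∀ c → h (t₁ c) ≡ h c
    inv₂ : ∀ c → h (t₂ c) ≡ h c
    inv₃ : ∀ c → h (t₃ c) ≡ h c
    inv₄ : ∀ c → h (t₄ c) ≡ h c
open Invariant

module _ {h : Cube₄ → ℤ} where

  -- A permutation of directions conjugates the translations into one another. With eta for pairs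
  -- this is definitional, so the fields are merely permuted.
  s₁₂-invariant : Invariant h → Invariant (h ∘ s₁₂)
  s₁₂-invariant i = record { inv₁ = λ c → inv₂ i (s₁₂ c) ; inv₂ = λ c → inv₁ i (s₁₂ c)
                           ; inv₃ = λ c → inv₃ i (s₁₂ c) ; inv₄ = λ c → inv₄ i (s₁₂ c) }

  s₂₃-invariant : Invariant h → Invariant (h ∘ s₂₃)
  s₂₃-invariant i = record { inv₁ = λ c → inv₁ i (s₂₃ c) ; inv₂ = λ c → inv₃ i (s₂₃ c)
                           ; inv₃ = λ c → inv₂ i (s₂₃ c) ; inv₄ = λ c → inv₄ i (s₂₃ c) }

  s₃₄-invariant : Invariant h → Invariant (h ∘ s₃₄)
  s₃₄-invariant i = record { inv₁ = λ c → inv₁ i (s₃₄ c) ; inv₂ = λ c → inv₂ i (s₃₄ c)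
                           ; inv₃ = λ c → inv₄ i (s₃₄ c) ; inv₄ = λ c → inv₃ i (s₃₄ c) }

+-invariant : {g h : Cube₄ → ℤ} → Invariant g → Invariant h → Invariant (λ c → g c + h c)
+-invariant i j = record { inv₁ = λ c → cong₂ _+_ (inv₁ i c) (inv₁ j c) ; inv₂ = λ c → cong₂ _+_ (inv₂ i c) (inv₂ j c)
                         ; inv₃ = λ c → cong₂ _+_ (inv₃ i c) (inv₃ j c) ; inv₄ = λ c → cong₂ _+_ (inv₄ i c) (inv₄ j c) }

-- The translations are commuting involutions by computation; each one just exchanges the two terms
-- of its own `symm`.
translates-invariant : (h : Cube₄ → ℤ) → Invariant (translates _+_ h)
translates-invariant h = record
  { inv₃ = λ c → +-comm (h₄ (t₃ c)) (h₄ c)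
  ; inv₄ = λ c → cong₂ _+_ (+-comm (h₁ (t₄ c)) (h₁ c)) (+-comm (h₁ (t₄ (t₃ c))) (h₁ (t₃ c)))
  ; inv₁ = λ c → cong₂ _+_ (cong₂ _+_ (i₁ c) (i₁ (t₄ c))) (cong₂ _+_ (i₁ (t₃ c)) (i₁ (t₄ (t₃ c))))
  ; inv₂ = λ c → cong₂ _+_ (cong₂ _+_ (i₂ c) (i₂ (t₄ c))) (cong₂ _+_ (i₂ (t₃ c)) (i₂ (t₄ (t₃ c)))) }
  where
  h₁ = symm _+_ t₁ (symm _+_ t₂ h)
  h₄ = symm _+_ t₄ h₁
  i₁ : ∀ c → h₁ (t₁ c) ≡ h₁ c
  i₁ c = +-comm (symm _+_ t₂ h (t₁ c)) (symm _+_ t₂ h c)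
  i₂ : ∀ c → h₁ (t₂ c) ≡ h₁ c
  i₂ c = cong₂ _+_ (+-comm (h (t₂ c)) (h c)) (+-comm (h (t₂ (t₁ c))) (h (t₁ c)))

faces-invariant : {h : Cube₄ → ℤ} → Invariant h → Invariant (faces _+_ h)
faces-invariant i = +-invariant
  (+-invariant i (+-invariant (s₂₃-invariant i) (s₁₂-invariant (s₂₃-invariant i))))
  (+-invariant (s₃₄-invariant (s₂₃-invariant i)) (+-invariant (s₁₂-invariant (s₃₄-invariant (s₂₃-invariant i)))
    (s₂₃-invariant (s₃₄-invariant (s₁₂-invariant (s₂₃-invariant i))))))

facets-invariant : {h : Cube₄ → ℤ} → Invariant h → Invariant (facets _+_ h)
facets-invariant i = +-invariant (+-invariant i (s₃₄-invariant i))
  (+-invariant (s₂₃-invariant (s₃₄-invariant i)) (s₁₂-invariant (s₂₃-invariant (s₃₄-invariant i))))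

-- Bounds in ℕ, where evaluation uses built-in arithmetic; the shift κ makes room for negative values.
Below : ℕ → (Cube₄ → ℤ) → (Cube₄ → ℕ) → Set
Below κ h g = ∀ c → h c + + κ ≤ + g c

+-below : ∀ {κ h g κ′ h′ g′} → Below κ h g → Below κ′ h′ g′ → Below (κ ℕ.+ κ′) (λ c → h c + h′ c) (λ c → g c ℕ.+ g′ c)
+-below {κ} {h} {g} {κ′} {h′} {g′} p q c =
  subst (_≤ + (g c ℕ.+ g′ c)) (sym (interchange (h c) (h′ c) (+ κ) (+ κ′))) (+-mono-≤ (p c) (q c))

∘-below : ∀ {κ h g} (σ : Cube₄ → Cube₄) → Below κ h g → Below κ (h ∘ σ) (g ∘ σ)
∘-below σ p c = p (σ c)

symm-below : ∀ {κ h g} (σ : Cube₄ → Cube₄) → Below κ h g → Below (κ ℕ.+ κ) (symm _+_ σ h) (symm ℕ._+_ σ g)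
symm-below {h = h} {g} σ p = +-below {h = h} {g} {h′ = h ∘ σ} {g ∘ σ} p (∘-below {h = h} {g} σ p)

-- Finite checks on cubes

∧-≡ : ∀ {a b} → a ∧ b ≡ true → a ≡ true × b ≡ true
∧-≡ {true} {true} refl = refl , refl

allBool : (Bool → Bool) → Bool
allBool p = p false ∧ p true

allBool-sound : (p : Bool → Bool) → allBool p ≡ true → ∀ b → p b ≡ true
allBool-sound p e false = proj₁ (∧-≡ e)
allBool-sound p e true  = proj₂ (∧-≡ {p false} e)

all₂ : (Cube₂ → Bool) → Bool
all₂ p = allBool λ a → allBool λ b → allBool λ c → allBool λ d → p ((a , b) , (c , d))

all₂-sound : (p : Cube₂ → Bool) → all₂ p ≡ true → ∀ x → p x ≡ true
all₂-sound p e ((a , b) , (c , d)) =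
  allBool-sound (λ d → p ((a , b) , (c , d)))
    (allBool-sound (λ c → allBool λ d → p ((a , b) , (c , d)))
      (allBool-sound (λ b → allBool λ c → allBool λ d → p ((a , b) , (c , d)))
        (allBool-sound (λ a → allBool λ b → allBool λ c → allBool λ d → p ((a , b) , (c , d))) e a) b) c) d

all₃ : (Cube₃ → Bool) → Bool
all₃ p = all₂ λ x → all₂ λ y → p (x , y)

all₃-sound : (p : Cube₃ → Bool) → all₃ p ≡ true → ∀ x → p x ≡ true
all₃-sound p e (x , y) = all₂-sound (λ y → p (x , y)) (all₂-sound (λ x → all₂ λ y → p (x , y)) e x) y

-- Tries memoise: evaluation shares their leaves between lookups.
data Trie : ℕ → Set where
  leaf : ℕ → Trie 0
  node : ∀ {m} → Trie m → Trie m → Trie (suc m)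

value : Trie 0 → ℕ
value (leaf x) = x

infixl 9 _!_
_!_ : ∀ {m} → Trie (suc m) → Bool → Trie m
node x y ! false = x
node x y ! true  = y

fork : ∀ {m} → (Bool → Trie m) → Trie (suc m)
fork f = node (f false) (f true)

fork-! : ∀ {m} (f : Bool → Trie m) b → fork f ! b ≡ f b
fork-! f false = refl
fork-! f true  = refl

tabulate₂ : ∀ {m} → (Cube₂ → Trie m) → Trie (4 ℕ.+ m)
tabulate₂ f = fork λ a → fork λ b → fork λ c → fork λ d → f ((a , b) , (c , d))

infixl 9 _!₂_
_!₂_ : ∀ {m} → Trie (4 ℕ.+ m) → Cube₂ → Trie m
t !₂ ((a , b) , (c , d)) = t ! a ! b ! c ! d

tabulate₂-! : ∀ {m} (f : Cube₂ → Trie m) x → tabulate₂ f !₂ x ≡ f x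
tabulate₂-! f ((a , b) , (c , d)) =
  trans (cong (λ t → t ! b ! c ! d) (fork-! (λ a → fork λ b → fork λ c → fork λ d → f ((a , b) , (c , d))) a))
  (trans (cong (λ t → t ! c ! d) (fork-! (λ b → fork λ c → fork λ d → f ((a , b) , (c , d))) b))
  (trans (cong (_! d) (fork-! (λ c → fork λ d → f ((a , b) , (c , d))) c))
         (fork-! (λ d → f ((a , b) , (c , d))) d)))

pop₂ : Cube₂ → ℕ
pop₂ ((a , b) , (c , d)) = bit a ℕ.+ bit b ℕ.+ bit c ℕ.+ bit d

rank pop : Cube₃ → ℕ
rank (x , y) = code x ℕ.+ 16 ℕ.* code y
pop (x , y) = pop₂ x ℕ.+ pop₂ y

u₁ u₂ u₃ : Cube₃ → Cube₃
u₁ = map₂ (map₂ swap)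
u₂ = map₂ swap
u₃ = swap

p₁₂ p₂₃ : Cube₃ → Cube₃
p₁₂ = map₂ transpose
p₂₃ = transpose

canonical : Cube₃ → Bool
canonical x = lower (u₁ x) ∧ lower (u₂ x) ∧ lower (u₃ x) ∧ lower (u₁ (u₂ x)) ∧ lower (u₁ (u₃ x)) ∧
              lower (u₂ (u₃ x)) ∧ lower (u₁ (u₂ (u₃ x)))
  where
  lower : Cube₃ → Bool
  lower y = rank x ≤ᵇ rank y

infixr 4 _⇒_
_⇒_ : Bool → Bool → Bool
true  ⇒ b = b
false ⇒ b = true

⇒-elim : ∀ {a b} → (a ⇒ b) ≡ true → a ≡ true → b ≡ true
⇒-elim {true} e refl = e

≡ᵇ-sound : ∀ {m n} → (m ≡ᵇ n) ≡ true → m ≡ n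
≡ᵇ-sound {m} {n} e = ℕ.≡ᵇ⇒≡ m n (Equivalence.from T-≡ e)

≤ᵇ-sound : ∀ {m n} → (m ≤ᵇ n) ≡ true → m ℕ.≤ n
≤ᵇ-sound {m} {n} e = ℕ.≤ᵇ⇒≤ m n (Equivalence.from T-≡ e)

≤ᵇ-complete : ∀ {m n} → m ℕ.≤ n → (m ≤ᵇ n) ≡ true
≤ᵇ-complete p = Equivalence.to T-≡ (ℕ.≤⇒≤ᵇ p)

∨-elim : {P : Set} → ∀ {a b} → a ∨ b ≡ true → (a ≡ true → P) → (b ≡ true → P) → P
∨-elim {a = true}  e f g = f refl
∨-elim {a = false} e f g = g e

boolEq-sound : ∀ {a b} → boolEq a b ≡ true → a ≡ b
boolEq-sound {true}  {true}  e = refl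
boolEq-sound {false} {false} e = refl

record Symmetric (p : Cube₃ → Bool) : Set where
  field
    sym-u₁  : ∀ x → p (u₁ x) ≡ p x
    sym-u₂  : ∀ x → p (u₂ x) ≡ p x
    sym-u₃  : ∀ x → p (u₃ x) ≡ p x
    sym-p₁₂ : ∀ x → p (p₁₂ x) ≡ p x
    sym-p₂₃ : ∀ x → p (p₂₃ x) ≡ p x

symmetric : (Cube₃ → Bool) → Cube₃ → Bool
symmetric p x = boolEq (p (u₁ x)) (p x) ∧ boolEq (p (u₂ x)) (p x) ∧ boolEq (p (u₃ x)) (p x) ∧
                boolEq (p (p₁₂ x)) (p x) ∧ boolEq (p (p₂₃ x)) (p x)

symmetric-sound : (p : Cube₃ → Bool) → all₃ (symmetric p) ≡ true → Symmetric p
symmetric-sound p e = record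
  { sym-u₁  = λ x → boolEq-sound (proj₁ (∧-≡ (r₁ x)))
  ; sym-u₂  = λ x → boolEq-sound (proj₁ (∧-≡ (r₂ x)))
  ; sym-u₃  = λ x → boolEq-sound (proj₁ (∧-≡ (r₃ x)))
  ; sym-p₁₂ = λ x → boolEq-sound (proj₁ (∧-≡ (r₄ x)))
  ; sym-p₂₃ = λ x → boolEq-sound (proj₂ (∧-≡ {boolEq (p (p₁₂ x)) (p x)} (r₄ x))) }
  where
  r₁ = all₃-sound (symmetric p) e
  r₂ = λ x → proj₂ (∧-≡ {boolEq (p (u₁ x)) (p x)} (r₁ x))
  r₃ = λ x → proj₂ (∧-≡ {boolEq (p (u₂ x)) (p x)} (r₂ x))
  r₄ = λ x → proj₂ (∧-≡ {boolEq (p (u₃ x)) (p x)} (r₃ x))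

pop-u₁ : ∀ x → pop (u₁ x) ≡ pop x
pop-u₁ x = ≡ᵇ-sound (all₃-sound (λ x → pop (u₁ x) ≡ᵇ pop x) refl x)

pop-u₂ : ∀ x → pop (u₂ x) ≡ pop x
pop-u₂ x = ≡ᵇ-sound (all₃-sound (λ x → pop (u₂ x) ≡ᵇ pop x) refl x)

pop-u₃ : ∀ x → pop (u₃ x) ≡ pop x
pop-u₃ x = ≡ᵇ-sound (all₃-sound (λ x → pop (u₃ x) ≡ᵇ pop x) refl x)

canonical-cover : ∀ x → canonical x ∨ canonical (u₁ x) ∨ canonical (u₂ x) ∨ canonical (u₃ x) ∨ canonical (u₁ (u₂ x)) ∨
                  canonical (u₁ (u₃ x)) ∨ canonical (u₂ (u₃ x)) ∨ canonical (u₁ (u₂ (u₃ x))) ≡ true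
canonical-cover = all₃-sound _ refl

-- Translating in direction 4 puts the facet with fewer points first. Translations in directions 1,
-- 2, 3 keep both cardinalities and make that facet the least of its orbit, which leaves (2⁸ + 7 ·
-- 2⁴)/8 = 46 first facets instead of 256.
checkRepresentatives : (Cube₄ → Bool) → Bool
checkRepresentatives p = all₃ λ x → canonical x ⇒ all₃ λ y → (pop x ≤ᵇ pop y) ⇒ p (x , y)

checkRepresentatives-sound : (p : Cube₄ → Bool) → checkRepresentatives p ≡ true →
  ∀ x y → canonical x ≡ true → pop x ℕ.≤ pop y → p (x , y) ≡ true
checkRepresentatives-sound p e x y e′ q = ⇒-elim (all₃-sound (λ y → (pop x ≤ᵇ pop y) ⇒ p (x , y))
  (⇒-elim (all₃-sound (λ x → canonical x ⇒ all₃ λ y → (pop x ≤ᵇ pop y) ⇒ p (x , y)) e x) e′) y) (≤ᵇ-complete q)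

module _ {h : Cube₄ → ℤ} (inv : Invariant h) (b : ℤ)
         (reps : ∀ x y → canonical x ≡ true → pop x ℕ.≤ pop y → h (x , y) ≤ b) where

  private
    Good : Cube₃ → Cube₃ → Set
    Good x y = pop x ℕ.≤ pop y → h (x , y) ≤ b

    via₁ : ∀ x y → Good (u₁ x) (u₁ y) → Good x y
    via₁ x y g p = subst (_≤ b) (inv₁ inv (x , y)) (g (subst₂ ℕ._≤_ (sym (pop-u₁ x)) (sym (pop-u₁ y)) p))

    via₂ : ∀ x y → Good (u₂ x) (u₂ y) → Good x y
    via₂ x y g p = subst (_≤ b) (inv₂ inv (x , y)) (g (subst₂ ℕ._≤_ (sym (pop-u₂ x)) (sym (pop-u₂ y)) p))

    via₃ : ∀ x y → Good (u₃ x) (u₃ y) → Good x y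
    via₃ x y g p = subst (_≤ b) (inv₃ inv (x , y)) (g (subst₂ ℕ._≤_ (sym (pop-u₃ x)) (sym (pop-u₃ y)) p))

    good : ∀ x y → Good x y
    good x y = ∨-elim (canonical-cover x) (reps x y)
      (λ e → ∨-elim e (λ e → via₁ x y (reps (u₁ x) (u₁ y) e))
      (λ e → ∨-elim e (λ e → via₂ x y (reps (u₂ x) (u₂ y) e))
      (λ e → ∨-elim e (λ e → via₃ x y (reps (u₃ x) (u₃ y) e))
      (λ e → ∨-elim e (λ e → via₂ x y (via₁ (u₂ x) (u₂ y) (reps (u₁ (u₂ x)) (u₁ (u₂ y)) e)))
      (λ e → ∨-elim e (λ e → via₃ x y (via₁ (u₃ x) (u₃ y) (reps (u₁ (u₃ x)) (u₁ (u₃ y)) e)))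
      (λ e → ∨-elim e (λ e → via₃ x y (via₂ (u₃ x) (u₃ y) (reps (u₂ (u₃ x)) (u₂ (u₃ y)) e)))
      (λ e → via₃ x y (via₂ (u₃ x) (u₃ y) (via₁ (u₂ (u₃ x)) (u₂ (u₃ y))
               (reps (u₁ (u₂ (u₃ x))) (u₁ (u₂ (u₃ y))) e))))))))))

  check-representatives : ∀ c → h c ≤ b
  check-representatives (x , y) with ℕ.≤-total (pop x) (pop y)
  ... | inj₁ p = good x y p
  ... | inj₂ p = subst (_≤ b) (inv₄ inv (x , y)) (good y x p)

pick : Bool → A × A → A
pick false = proj₁
pick true  = proj₂

at : ∀ {k} → Cube A k → Point k → A
at {k = zero}  c []      = c
at {k = suc k} c (b ∷ v) = pick b (at {k = k} c v)

permutations : List (Point 3 → Point 3)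
permutations = (λ { (x ∷ y ∷ z ∷ []) → x ∷ y ∷ z ∷ [] }) ∷ (λ { (x ∷ y ∷ z ∷ []) → x ∷ z ∷ y ∷ [] }) ∷
               (λ { (x ∷ y ∷ z ∷ []) → y ∷ x ∷ z ∷ [] }) ∷ (λ { (x ∷ y ∷ z ∷ []) → y ∷ z ∷ x ∷ [] }) ∷
               (λ { (x ∷ y ∷ z ∷ []) → z ∷ x ∷ y ∷ [] }) ∷ (λ { (x ∷ y ∷ z ∷ []) → z ∷ y ∷ x ∷ [] }) ∷ []

automorphisms : List (Point 3 → Point 3)
automorphisms = concatMap (λ t → map (λ π x → zipWith _xor_ t (π x)) permutations) (allPoints 3)

agrees : ∀ {d} → Config d → Config d → Bool
agrees {d} H K = all (λ x → boolEq (H x) (K x)) (allPoints d)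

agreesAlong : ∀ {d} → List (Point d → Point d) → Config d → Config d → Bool
agreesAlong fs H K = any (λ f → agrees H (K ∘ f)) fs

isCopy : Config 3 → Cube₃ → Bool
isCopy H c = agreesAlong automorphisms H (at {k = 3} c)

-- Certificates and their tabulated evaluation

+-cancelʳ-≤ : ∀ k i j → i + k ≤ j + k → i ≤ j
+-cancelʳ-≤ k i j p = subst₂ _≤_ (cancel i) (cancel j) (+-monoˡ-≤ (- k) p)
  where
  cancel : ∀ i → i + k + - k ≡ i
  cancel i = trans (+-assoc i k (- k)) (trans (cong (_+_ i) (+-inverseʳ k)) (+-identityʳ i))

bound-below : ∀ κ z → z + + κ ≤ + ∣ z + + κ ∣
bound-below κ z with z + + κ
... | + m      = ≤-refl
... | -[1+ m ] = -≤+

faces-below : ∀ {κ h g} → Below κ h g →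
  Below ((κ ℕ.+ (κ ℕ.+ κ)) ℕ.+ (κ ℕ.+ (κ ℕ.+ κ))) (faces _+_ h) (faces ℕ._+_ g)
faces-below {κ} {h} {g} p =
  +-below {h = λ c → h c + (h (s₂₃ c) + h (s₂₃ (s₁₂ c)))} {λ c → g c ℕ.+ (g (s₂₃ c) ℕ.+ g (s₂₃ (s₁₂ c)))}
    (+-below {h = h} {g} p (+-below {h = h ∘ s₂₃} {g ∘ s₂₃} (p ∘ s₂₃) (p ∘ s₂₃ ∘ s₁₂)))
    (+-below {h = h ∘ s₂₃ ∘ s₃₄} {g ∘ s₂₃ ∘ s₃₄} (p ∘ s₂₃ ∘ s₃₄)
      (+-below {h = h ∘ s₂₃ ∘ s₃₄ ∘ s₁₂} {g ∘ s₂₃ ∘ s₃₄ ∘ s₁₂} (p ∘ s₂₃ ∘ s₃₄ ∘ s₁₂) (p ∘ s₂₃ ∘ s₁₂ ∘ s₃₄ ∘ s₂₃)))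

facets-below : ∀ {κ h g} → Below κ h g → Below ((κ ℕ.+ κ) ℕ.+ (κ ℕ.+ κ)) (facets _+_ h) (facets ℕ._+_ g)
facets-below {κ} {h} {g} p =
  +-below {h = λ c → h c + h (s₃₄ c)} {λ c → g c ℕ.+ g (s₃₄ c)} (+-below {h = h} {g} p (p ∘ s₃₄))
    (+-below {h = h ∘ s₃₄ ∘ s₂₃} {g ∘ s₃₄ ∘ s₂₃} (p ∘ s₃₄ ∘ s₂₃) (p ∘ s₃₄ ∘ s₂₃ ∘ s₁₂))

translates-below : ∀ {κ h g} → Below κ h g →
  Below (((κ ℕ.+ κ) ℕ.+ (κ ℕ.+ κ)) ℕ.+ ((κ ℕ.+ κ) ℕ.+ (κ ℕ.+ κ)) ℕ.+
         (((κ ℕ.+ κ) ℕ.+ (κ ℕ.+ κ)) ℕ.+ ((κ ℕ.+ κ) ℕ.+ (κ ℕ.+ κ)))) (translates _+_ h) (translates ℕ._+_ g)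
translates-below {κ} {h} {g} p = symm-below {h = h₄} {g₄} t₃ (symm-below {h = h₁} {g₁} t₄
    (symm-below {h = h₂} {g₂} t₁ (symm-below {h = h} {g} t₂ p)))
  where
  h₂ = symm _+_ t₂ h ; h₁ = symm _+_ t₁ h₂ ; h₄ = symm _+_ t₄ h₁
  g₂ = symm ℕ._+_ t₂ g ; g₁ = symm ℕ._+_ t₁ g₂ ; g₄ = symm ℕ._+_ t₄ g₁

-- `base` is the face in directions 1, 2; `ext₁` and `ext₂` are its translates in directions 3 and
-- 4; `cross` is the face in directions 3, 4 at the same vertex.
base ext₁ ext₂ cross : Cube₄ → Cube₂
base  c = proj₁ (proj₁ c)
ext₁  c = proj₂ (proj₁ c)
ext₂  c = proj₁ (proj₂ c)
cross (((((a , _) , _) , ((b , _) , _))) , (((c , _) , _) , ((d , _) , _))) = (a , b) , (c , d)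

-- The bounds hold for any shift (z ≤ ∣ z ∣) and are sharp once it makes all table entries nonnegative.
κ₀ : ℕ
κ₀ = 100000

record Fast (h : Cube₄ → ℤ) : Set where
  field
    {depth} : ℕ
    shift   : ℕ
    table   : Trie depth
    fast    : Trie depth → Cube₄ → ℕ
    below   : Below shift h (fast table)

module Faces (F : ℕ → Form) where

  φ : Cube₄ → ℤ
  φ c = eval (F (code (base c))) (code (ext₁ c)) (code (ext₂ c))

  -- `φ` reads three of the four parallel faces, and `t₁`, `t₂` act inside each face. So 12 bits
  -- determine the value, and `s` fills the place of the fourth face.
  φ⁺ : Cube₂ → Cube₂ → Cube₂ → ℤ
  φ⁺ s x y = symm _+_ t₁ (symm _+_ t₂ φ) ((s , x) , (y , s))

  φ-table : Trie 12
  φ-table = tabulate₂ (λ s → tabulate₂ λ x → tabulate₂ λ y → leaf ∣ φ⁺ s x y + + κ₀ ∣)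

  φ′ : Trie 12 → Cube₄ → ℕ
  φ′ t c = value (t !₂ base c !₂ ext₁ c !₂ ext₂ c)

  φ-below : Below κ₀ (symm _+_ t₁ (symm _+_ t₂ φ)) (φ′ φ-table)
  φ-below ((s , x) , (y , _)) = subst (λ m → φ⁺ s x y + + κ₀ ≤ + m) (sym lookup) (bound-below κ₀ (φ⁺ s x y))
    where
    lookup : φ′ φ-table ((s , x) , (y , s)) ≡ ∣ φ⁺ s x y + + κ₀ ∣
    lookup = cong value (trans (cong (λ t → t !₂ x !₂ y)
        (tabulate₂-! (λ s → tabulate₂ λ x → tabulate₂ λ y → leaf ∣ φ⁺ s x y + + κ₀ ∣) s))
      (trans (cong (_!₂ y) (tabulate₂-! (λ x → tabulate₂ λ y → leaf ∣ φ⁺ s x y + + κ₀ ∣) x))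
             (tabulate₂-! (λ y → leaf ∣ φ⁺ s x y + + κ₀ ∣) y)))

  faces-fast : Fast (faces _+_ (translates _+_ φ))
  faces-fast = record
    { shift = 24 ℕ.* κ₀ ; table = φ-table
    ; fast  = λ t → faces ℕ._+_ (symm ℕ._+_ t₃ (symm ℕ._+_ t₄ (φ′ t)))
    ; below = faces-below {h = translates _+_ φ} {symm ℕ._+_ t₃ (symm ℕ._+_ t₄ (φ′ φ-table))}
        (symm-below {h = symm _+_ t₄ φ₁} {symm ℕ._+_ t₄ (φ′ φ-table)} t₃ (symm-below {h = φ₁} {φ′ φ-table} t₄ φ-below)) }
    where φ₁ = symm _+_ t₁ (symm _+_ t₂ φ)

module Vertices (G : Form) where

  χ : Cube₄ → ℤ
  χ c = + 2 * eval G (code (base c)) (code (cross c))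

  -- The three matchings together read the six 2-faces at the base vertex, that is, the 11 points
  -- with at most two coordinates equal to 1: four in `s` and `a` to `g`. The other five places are
  -- filled with `a`.
  χ⁺ : Cube₂ → Bool → Bool → Bool → Bool → Bool → Bool → Bool → ℤ
  χ⁺ s a b c d e f g = matchings _+_ χ ((s , ((a , b) , (c , a))) , (((d , e) , (f , a)) , ((g , a) , (a , a))))

  χ-table : Trie 11
  χ-table = tabulate₂ λ s → fork λ a → fork λ b → fork λ c → fork λ d → fork λ e → fork λ f → fork λ g →
              leaf ∣ χ⁺ s a b c d e f g + + κ₀ ∣

  χ′ : Trie 11 → Cube₄ → ℕ
  χ′ t ((s , ((a , b) , (c , _))) , (((d , e) , (f , _)) , ((g , _) , _))) = value (t !₂ s ! a ! b ! c ! d ! e ! f ! g)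

  χ-below : Below κ₀ (matchings _+_ χ) (χ′ χ-table)
  χ-below ((s , ((a , b) , (c , _))) , (((d , e) , (f , _)) , ((g , _) , _))) =
    subst (λ m → χ⁺ s a b c d e f g + + κ₀ ≤ + m) (sym lookup) (bound-below κ₀ (χ⁺ s a b c d e f g))
    where
    T₇ : Cube₂ → Trie 7
    T₇ s = fork λ a → fork λ b → fork λ c → fork λ d → fork λ e → fork λ f → fork λ g → leaf ∣ χ⁺ s a b c d e f g + + κ₀ ∣
    T₆ = λ a → fork λ b → fork λ c → fork λ d → fork λ e → fork λ f → fork λ g → leaf ∣ χ⁺ s a b c d e f g + + κ₀ ∣
    T₅ = λ b → fork λ c → fork λ d → fork λ e → fork λ f → fork λ g → leaf ∣ χ⁺ s a b c d e f g + + κ₀ ∣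
    T₄ = λ c → fork λ d → fork λ e → fork λ f → fork λ g → leaf ∣ χ⁺ s a b c d e f g + + κ₀ ∣
    T₃ = λ d → fork λ e → fork λ f → fork λ g → leaf ∣ χ⁺ s a b c d e f g + + κ₀ ∣
    T₂ = λ e → fork λ f → fork λ g → leaf ∣ χ⁺ s a b c d e f g + + κ₀ ∣
    T₁ = λ f → fork λ g → leaf ∣ χ⁺ s a b c d e f g + + κ₀ ∣
    T₀ = λ g → leaf ∣ χ⁺ s a b c d e f g + + κ₀ ∣
    lookup : value (χ-table !₂ s ! a ! b ! c ! d ! e ! f ! g) ≡ ∣ χ⁺ s a b c d e f g + + κ₀ ∣
    lookup = cong value (trans (cong (λ t → t ! a ! b ! c ! d ! e ! f ! g) (tabulate₂-! T₇ s))
      (trans (cong (λ t → t ! b ! c ! d ! e ! f ! g) (fork-! T₆ a)) (trans (cong (λ t → t ! c ! d ! e ! f ! g) (fork-! T₅ b))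
      (trans (cong (λ t → t ! d ! e ! f ! g) (fork-! T₄ c)) (trans (cong (λ t → t ! e ! f ! g) (fork-! T₃ d))
      (trans (cong (λ t → t ! f ! g) (fork-! T₂ e)) (trans (cong (_! g) (fork-! T₁ f)) (fork-! T₀ g))))))))

  vertices-fast : Fast (translates _+_ (matchings _+_ χ))
  vertices-fast = record { shift = 16 ℕ.* κ₀ ; table = χ-table ; fast = λ t → translates ℕ._+_ (χ′ t)
    ; below = translates-below {h = matchings _+_ χ} {χ′ χ-table} χ-below }

zero-fast : Fast (λ _ → 0ℤ)
zero-fast = record { shift = 0 ; table = leaf 0 ; fast = λ _ _ → 0 ; below = λ _ → ≤-refl }

facesPart : Maybe (ℕ → Form) → Cube₄ → ℤ
facesPart nothing  = λ _ → 0ℤ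
facesPart (just F) = faces _+_ (translates _+_ (Faces.φ F))

verticesPart : Maybe Form → Cube₄ → ℤ
verticesPart nothing  = λ _ → 0ℤ
verticesPart (just G) = translates _+_ (matchings _+_ (Vertices.χ G))

facesPart-fast : ∀ F → Fast (facesPart F)
facesPart-fast nothing  = zero-fast
facesPart-fast (just F) = Faces.faces-fast F

verticesPart-fast : ∀ G → Fast (verticesPart G)
verticesPart-fast nothing  = zero-fast
verticesPart-fast (just G) = Vertices.vertices-fast G

0-invariant : Invariant {ℤ} (λ _ → 0ℤ)
0-invariant = record { inv₁ = λ _ → refl ; inv₂ = λ _ → refl ; inv₃ = λ _ → refl ; inv₄ = λ _ → refl }

facesPart-invariant : ∀ F → Invariant (facesPart F)
facesPart-invariant nothing  = 0-invariant
facesPart-invariant (just F) = faces-invariant (translates-invariant (Faces.φ F))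

verticesPart-invariant : ∀ G → Invariant (verticesPart G)
verticesPart-invariant nothing  = 0-invariant
verticesPart-invariant (just G) = translates-invariant (matchings _+_ (Vertices.χ G))

-- A certificate: F gives, for each configuration of a 2-face, squares of linear forms in the densities of
-- its parallel faces; G gives squares of linear forms in the densities of the 2-faces at a vertex.  The weights 1, 2 and
-- 12 den put 6 · 16 faces, 3 · 16 pairs of faces at a vertex and 8 facets on the common scale 96.
module Certificate (F : Maybe (ℕ → Form)) (G : Maybe Form) (p : Cube₃ → Bool) (den num : ℕ) where

  δ : Cube₄ → ℤ
  δ c = + (12 ℕ.* den) * + bit (p (proj₁ c))

  total : Cube₄ → ℤ
  total c = facesPart F c + (verticesPart G c + facets _+_ (symm _+_ t₄ δ) c)

  private
    module F = Fast (facesPart-fast F)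
    module G = Fast (verticesPart-fast G)

  Tables : Set
  Tables = Trie F.depth × Trie G.depth × Trie 8

  tables : Tables
  tables = F.table , G.table , tabulate₂ (λ x → tabulate₂ λ y → leaf ∣ + (12 ℕ.* den) * + bit (p (x , y)) + + 0 ∣)

  δ′ : Trie 8 → Cube₄ → ℕ
  δ′ t c = value (t !₂ base c !₂ ext₁ c)

  total′ : Tables → Cube₄ → ℕ
  total′ (t₁ , t₂ , t₃) c = F.fast t₁ c ℕ.+ (G.fast t₂ c ℕ.+ facets ℕ._+_ (symm ℕ._+_ t₄ (δ′ t₃)) c)

  shift : ℕ
  shift = F.shift ℕ.+ (G.shift ℕ.+ 0)

  -- The tables are an argument so that evaluation shares them.
  check : Tables → Bool
  check t = checkRepresentatives λ c → total′ t c ≤ᵇ 96 ℕ.* num ℕ.+ shift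

  check-sound : ∀ t → check t ≡ true → ∀ x y → canonical x ≡ true → pop x ℕ.≤ pop y →
                (total′ t (x , y) ≤ᵇ 96 ℕ.* num ℕ.+ shift) ≡ true
  check-sound t = checkRepresentatives-sound λ c → total′ t c ≤ᵇ 96 ℕ.* num ℕ.+ shift

  δ-below : Below 0 δ (δ′ (proj₂ (proj₂ tables)))
  δ-below c = subst (λ m → δ c + + 0 ≤ + m) (sym lookup) (bound-below 0 (δ c))
    where
    f : Cube₂ → Cube₂ → Trie 0
    f x y = leaf ∣ + (12 ℕ.* den) * + bit (p (x , y)) + + 0 ∣
    lookup : δ′ (proj₂ (proj₂ tables)) c ≡ ∣ δ c + + 0 ∣
    lookup = cong value (trans (cong (_!₂ ext₁ c) (tabulate₂-! (λ s → tabulate₂ (f s)) (base c)))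
                               (tabulate₂-! (f (base c)) (ext₁ c)))

  total-below : Below shift total (total′ tables)
  total-below = +-below {h = facesPart F} {F.fast F.table} {h′ = λ c → verticesPart G c + facets _+_ (symm _+_ t₄ δ) c}
    F.below (+-below {h = verticesPart G} {G.fast G.table} {h′ = facets _+_ (symm _+_ t₄ δ)} {facets ℕ._+_ (symm ℕ._+_ t₄ δ⁺)}
      G.below (facets-below {h = symm _+_ t₄ δ} {symm ℕ._+_ t₄ δ⁺} (symm-below {h = δ} {δ⁺} t₄ δ-below)))
    where δ⁺ = δ′ (proj₂ (proj₂ tables))

  module _ (p-symmetric : Symmetric p) where

    open Symmetric p-symmetric

    total-invariant : Invariant total
    total-invariant = +-invariant (facesPart-invariant F) (+-invariant (verticesPart-invariant G) (facets-invariant δ-invariant))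
      where
      δ₃ : Cube₃ → ℤ
      δ₃ x = + (12 ℕ.* den) * + bit (p x)
      weight : ∀ {x y} → p x ≡ p y → δ₃ x ≡ δ₃ y
      weight = cong λ b → + (12 ℕ.* den) * + bit b
      δ-invariant : Invariant (symm _+_ t₄ δ)
      δ-invariant = record
        { inv₁ = λ c → cong₂ _+_ (weight (sym-u₁ (proj₁ c))) (weight (sym-u₁ (proj₂ c)))
        ; inv₂ = λ c → cong₂ _+_ (weight (sym-u₂ (proj₁ c))) (weight (sym-u₂ (proj₂ c)))
        ; inv₃ = λ c → cong₂ _+_ (weight (sym-u₃ (proj₁ c))) (weight (sym-u₃ (proj₂ c)))
        ; inv₄ = λ c → +-comm (δ₃ (proj₂ c)) (δ₃ (proj₁ c)) }

    total≤ : check tables ≡ true → ∀ c → total c ≤ + (96 ℕ.* num)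
    total≤ checked = check-representatives total-invariant (+ (96 ℕ.* num)) λ x y e q →
      +-cancelʳ-≤ (+ shift) (total (x , y)) (+ (96 ℕ.* num)) (≤-trans (total-below (x , y))
        (+≤+ (≤ᵇ-sound (check-sound tables checked x y e q))))

-- From the pointwise check to a bound on the copies

module Multiples {n : ℕ} (S : Config n) where

  open Averages S

  -- E h ≡ + a * e as a relation, so that the functions are not lost to unification.
  record Multiple (h : Cube₄ → ℤ) (a : ℕ) (e : ℤ) : Set where
    constructor multiple
    field equation : E h ≡ + a * e
  open Multiple public

  one : ∀ h → Multiple h 1 (E h)
  one h = multiple (sym (*-identityˡ (E h)))

  plus : ∀ {g h e a b} → Multiple g a e → Multiple h b e → Multiple (λ c → g c + h c) (a ℕ.+ b) e
  plus {g} {h} {e} {a} {b} (multiple p) (multiple q) =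
    multiple (trans (E-+ g h) (trans (cong₂ _+_ p q) (sym (*-distribʳ-+ e (+ a) (+ b)))))

  via : ∀ σ {h e a} → Symmetry σ → Multiple h a e → Multiple (h ∘ σ) a e
  via σ {h} s (multiple p) = multiple (trans (s h) p)

  E-symm : ∀ σ {h e a} → Symmetry σ → Multiple h a e → Multiple (symm _+_ σ h) (a ℕ.+ a) e
  E-symm σ s p = plus p (via σ s p)

  E-translates : ∀ h → Multiple (translates _+_ h) 16 (E h)
  E-translates h = E-symm t₃ t₃-symmetry (E-symm t₄ t₄-symmetry (E-symm t₁ t₁-symmetry (E-symm t₂ t₂-symmetry (one h))))

  E-faces : ∀ {h e a} → Multiple h a e → Multiple (faces _+_ h) ((a ℕ.+ (a ℕ.+ a)) ℕ.+ (a ℕ.+ (a ℕ.+ a))) e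
  E-faces p = plus (plus p (plus p₂ (via s₁₂ s₁₂-symmetry p₂)))
    (plus p₃ (plus (via s₁₂ s₁₂-symmetry p₃) (via s₂₃ s₂₃-symmetry (via s₃₄ s₃₄-symmetry (via s₁₂ s₁₂-symmetry p₂)))))
    where
    p₂ = via s₂₃ s₂₃-symmetry p
    p₃ = via s₃₄ s₃₄-symmetry p₂

  E-matchings : ∀ {h e a} → Multiple h a e → Multiple (matchings _+_ h) (a ℕ.+ (a ℕ.+ a)) e
  E-matchings p = plus p (plus p₂ (via s₃₄ s₃₄-symmetry p₂))
    where p₂ = via s₂₃ s₂₃-symmetry p

  E-facets : ∀ {h e a} → Multiple h a e → Multiple (facets _+_ h) ((a ℕ.+ a) ℕ.+ (a ℕ.+ a)) e
  E-facets p = plus (plus p p₃) (plus p₂ (via s₁₂ s₁₂-symmetry p₂))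
    where
    p₃ = via s₃₄ s₃₄-symmetry p
    p₂ = via s₂₃ s₂₃-symmetry p₃

  E₃ : (Cube₃ → ℤ) → ℤ
  E₃ h = ∑ (allPoints n) λ v → ∑ Ds λ i → ∑ Ds λ j → ∑ Ds λ k → h (cube₃ i j k v)

  E₃-*ˡ : ∀ a h → E₃ (λ x → a * h x) ≡ a * E₃ h
  E₃-*ˡ a h = trans (∑-cong _ λ v → trans (∑-cong Ds λ i → trans (∑-cong Ds λ j →
      ∑-*ˡ Ds a _) (∑-*ˡ Ds a _)) (∑-*ˡ Ds a _)) (∑-*ˡ (allPoints n) a _)

  E-proj₁ : ∀ h → E (h ∘ proj₁) ≡ + n * E₃ h
  E-proj₁ h = trans (∑-cong _ λ v → ∑-cong Ds λ i → ∑-cong Ds λ j → ∑-cong Ds λ k →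
      trans (∑-const Ds (h (cube₃ i j k v))) (cong (λ m → + m * h (cube₃ i j k v)) (length-tabulate {n = n} id)))
    (E₃-*ˡ (+ n) h)

scale : ∀ k a m d x → + k * (+ suc m * (+ (a ℕ.* d) * x)) ≡ + (k ℕ.* a) * (+ suc m * (+ d * x))
scale k a m d x = begin
  + k * (+ suc m * (+ (a ℕ.* d) * x))       ≡⟨ cong (λ z → + k * (+ suc m * (z * x))) (pos-* a d) ⟩
  + k * (+ suc m * (+ a * + d * x))         ≡⟨ cong (λ z → + k * (+ suc m * z)) (*-assoc (+ a) (+ d) x) ⟩
  + k * (+ suc m * (+ a * (+ d * x)))       ≡⟨ cong (+ k *_) (x∙yz≈y∙xz (+ suc m) (+ a) (+ d * x)) ⟩
  + k * (+ a * (+ suc m * (+ d * x)))       ≡⟨ sym (*-assoc (+ k) (+ a) _) ⟩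
  + k * + a * (+ suc m * (+ d * x))         ≡⟨ cong (_* (+ suc m * (+ d * x))) (sym (pos-* k a)) ⟩
  + (k ℕ.* a) * (+ suc m * (+ d * x))       ∎
  where
  open ≡-Reasoning
  open import Algebra.Properties.CommutativeSemigroup *-commutativeSemigroup using (x∙yz≈y∙xz)

-- `f` and `x` are the sums of squares, which are dropped. The idle fourth direction contributes the
-- factor `suc m` on both sides; it cancels together with 96 = 8 · 12.
combine : ∀ m den num f x d c o → 0ℤ ≤ f → 0ℤ ≤ x → d ≡ + suc m * (+ (12 ℕ.* den) * c) → ∀ {r} →
  r ≡ + suc m * (+ (96 ℕ.* num) * o) → f + (x + + 8 * d) ≤ r → + den * c ≤ + num * o
combine m den num f x d c o f≥0 x≥0 refl refl p =
  *-cancelˡ-≤-pos (+ den * c) (+ num * o) (+ suc m) (*-cancelˡ-≤-pos (+ suc m * (+ den * c)) (+ suc m * (+ num * o)) (+ 96) chain)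
  where
  open ≤-Reasoning
  chain : + 96 * (+ suc m * (+ den * c)) ≤ + 96 * (+ suc m * (+ num * o))
  chain = begin
    + 96 * (+ suc m * (+ den * c))            ≡⟨ sym (scale 8 12 m den c) ⟩
    + 8 * d                                 ≡⟨ sym (trans (+-identityˡ _) (+-identityˡ _)) ⟩
    0ℤ + (0ℤ + + 8 * d)                     ≤⟨ +-mono-≤ f≥0 (+-monoˡ-≤ (+ 8 * d) x≥0) ⟩
    f + (x + + 8 * d)                       ≤⟨ p ⟩
    + suc m * (+ (96 ℕ.* num) * o)            ≡⟨ sym (*-identityˡ _) ⟩
    + 1 * (+ suc m * (+ (96 ℕ.* num) * o))    ≡⟨ scale 1 96 m num o ⟩
    + 96 * (+ suc m * (+ num * o))            ∎

module Nonnegative {n : ℕ} (S : Config n) where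

  open Averages S
  open Multiples S

  -- `ext₁` and `ext₂` of `cube₄ i j k l v` compute to `cube₂ i j` at `flip k v` and at `flip l v`.
  -- With the base face fixed, `k` and `l` range independently over the same faces, which gives
  -- weighted squares.
  Eφ≥0 : (F : ℕ → Form) → 0ℤ ≤ E (Faces.φ F)
  Eφ≥0 F = ∑-nonneg _ λ v → ∑-nonneg Ds λ i → ∑-nonneg Ds λ j →
    ∑∑-eval-nonneg (F (code (cube₂ i j v))) Ds (λ k → code (cube₂ i j (flip k v)))

  -- `cross (cube₄ i j k l v)` computes to `cube₂ k l v`, so at a fixed vertex the four sums form a
  -- double sum over the single index set `pairs Ds`.
  Eχ≥0 : (G : Form) → 0ℤ ≤ E (Vertices.χ G)
  Eχ≥0 G = subst (0ℤ ≤_) (sym (E-*ˡ (+ 2) χ₀)) (*-monoˡ-≤-nonNeg (+ 2) (∑-nonneg _ λ v → subst (0ℤ ≤_) (eq v)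
      (∑∑-eval-nonneg G (pairs Ds) (λ p → code (cube₂ (proj₁ p) (proj₂ p) v)))))
    where
    χ₀ : Cube₄ → ℤ
    χ₀ c = eval G (code (base c)) (code (cross c))
    eq : ∀ v → ∑ (pairs Ds) (λ p → ∑ (pairs Ds) λ q → eval G (code (cube₂ (proj₁ p) (proj₂ p) v)) (code (cube₂ (proj₁ q) (proj₂ q) v)))
             ≡ ∑ Ds λ i → ∑ Ds λ j → ∑ Ds λ k → ∑ Ds λ l → χ₀ (cube₄ i j k l v)
    eq v = trans (∑-pairs Ds (λ i j → ∑ (pairs Ds) λ q → eval G (code (cube₂ i j v)) (code (cube₂ (proj₁ q) (proj₂ q) v))))
      (∑-cong Ds λ i → ∑-cong Ds λ j → ∑-pairs Ds (λ k l → eval G (code (cube₂ i j v)) (code (cube₂ k l v))))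

  multiple-nonneg : ∀ {h a e} → Multiple h a e → 0ℤ ≤ e → 0ℤ ≤ E h
  multiple-nonneg {a = a} {e} (multiple q) p =
    subst (0ℤ ≤_) (sym q) (subst (_≤ + a * e) (*-zeroʳ (+ a)) (*-monoˡ-≤-nonNeg (+ a) p))

  E-facesPart≥0 : ∀ F → 0ℤ ≤ E (facesPart F)
  E-facesPart≥0 nothing  = ∑-nonneg _ λ v → ∑-nonneg Ds λ i → ∑-nonneg Ds λ j → ∑-nonneg Ds λ k → ∑-nonneg Ds λ l → ≤-refl
  E-facesPart≥0 (just F) = multiple-nonneg (E-faces (E-translates (Faces.φ F))) (Eφ≥0 F)

  E-verticesPart≥0 : ∀ G → 0ℤ ≤ E (verticesPart G)
  E-verticesPart≥0 nothing  = ∑-nonneg _ λ v → ∑-nonneg Ds λ i → ∑-nonneg Ds λ j → ∑-nonneg Ds λ k → ∑-nonneg Ds λ l → ≤-refl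
  E-verticesPart≥0 (just G) = multiple-nonneg (E-translates (matchings _+_ χ)) (multiple-nonneg (E-matchings (one χ)) (Eχ≥0 G))
    where χ = Vertices.χ G

module Bound (F : Maybe (ℕ → Form)) (G : Maybe Form) (p : Cube₃ → Bool) (den num : ℕ) (p-symmetric : Symmetric p)
  (checked : Certificate.check F G p den num (Certificate.tables F G p den num) ≡ true)
  {m : ℕ} (S : Config (suc m)) where

  open Certificate F G p den num
  open Averages S
  open Multiples S
  open Nonnegative S

  private
    copies : Cube₃ → ℤ
    copies x = + bit (p x)

  E-total : E total ≡ E (facesPart F) + (E (verticesPart G) + + 8 * E δ)
  E-total = trans (E-+ (facesPart F) (λ c → verticesPart G c + h₃ c)) (cong (_+_ (E (facesPart F)))
    (trans (E-+ (verticesPart G) h₃) (cong (_+_ (E (verticesPart G))) (equation (E-facets (E-symm t₄ t₄-symmetry (one δ)))))))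
    where h₃ = facets _+_ (symm _+_ t₄ δ)

  E-copies≤ : + den * E₃ (λ x → + bit (p x)) ≤ + num * E₃ (λ _ → 1ℤ)
  E-copies≤ = combine m den num (E (facesPart F)) (E (verticesPart G)) (E δ) (E₃ copies) (E₃ (λ _ → 1ℤ))
    (E-facesPart≥0 F) (E-verticesPart≥0 G) Eδ rhs
    (subst (_≤ E (λ _ → + (96 ℕ.* num))) E-total (E-mono (total≤ p-symmetric checked)))
    where
    Eδ : E δ ≡ + suc m * (+ (12 ℕ.* den) * E₃ copies)
    Eδ = trans (E-proj₁ (λ x → + (12 ℕ.* den) * copies x)) (cong (+ suc m *_) (E₃-*ˡ (+ (12 ℕ.* den)) copies))
    rhs : E (λ _ → + (96 ℕ.* num)) ≡ + suc m * (+ (96 ℕ.* num) * E₃ (λ _ → 1ℤ))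
    rhs = trans (E-cong (λ _ → sym (*-identityʳ (+ (96 ℕ.* num)))))
      (trans (E-proj₁ (λ _ → + (96 ℕ.* num) * 1ℤ)) (cong (+ suc m *_) (E₃-*ˡ (+ (96 ℕ.* num)) (λ _ → 1ℤ))))

-- Counting subcubes

-- The value of Φ on the configuration induced on the subcube c if c has f flip bits, and 0 otherwise.
restrict : ∀ f → (Point n → A) → (Cube A f → ℤ) → Pattern n → ℤ
restrict zero    S Φ []            = Φ (S [])
restrict (suc f) S Φ []            = 0ℤ
restrict f       S Φ (just b ∷ c)  = restrict f (S ∘ (b ∷_)) Φ c
restrict zero    S Φ (nothing ∷ c) = 0ℤ
restrict (suc f) S Φ (nothing ∷ c) = restrict f (λ u → S (false ∷ u) , S (true ∷ u)) Φ c

∑-allPatterns : ∀ n (g : Pattern (suc n) → ℤ) →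
  ∑ (allPatterns (suc n)) g ≡ ∑ (allPatterns n) (λ c → g (nothing ∷ c)) +
    (∑ (allPatterns n) (λ c → g (just false ∷ c)) + ∑ (allPatterns n) (λ c → g (just true ∷ c)))
∑-allPatterns n g = trans (∑-concatMap _ (allPatterns n) g)
  (trans (∑-cong (allPatterns n) λ c → trans (∑-∷ _ _ g) (cong (_+_ (g (nothing ∷ c))) (∑-pair _ _ g)))
  (trans (∑-+ (allPatterns n) (λ c → g (nothing ∷ c)) _)
    (cong (_+_ (∑ (allPatterns n) (λ c → g (nothing ∷ c)))) (∑-+ (allPatterns n) (λ c → g (just false ∷ c)) _))))

∑-allFin : ∀ n (f : Fin (suc n) → ℤ) → ∑ (allFin (suc n)) f ≡ f zero + ∑ (allFin n) (f ∘ suc)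
∑-allFin n f = trans (∑-∷ zero _ f) (cong (_+_ (f zero))
  (trans (cong (λ xs → ∑ xs f) (sym (map-tabulate {n = n} id suc))) (∑-map suc (allFin n) f)))

-- The sum over increasing sequences of directions.
inc : ∀ f n → (Vec (Fin n) f → ℤ) → ℤ
inc zero    n       h = h []
inc (suc f) zero    h = 0ℤ
inc (suc f) (suc n) h = inc f n (λ is → h (zero ∷ Vec.map suc is)) + inc (suc f) n (λ is → h (Vec.map suc is))

inc-cong : ∀ f n {g h : Vec (Fin n) f → ℤ} → (∀ is → g is ≡ h is) → inc f n g ≡ inc f n h
inc-cong zero    n       e = e []
inc-cong (suc f) zero    e = refl
inc-cong (suc f) (suc n) e = cong₂ _+_ (inc-cong f n λ is → e _) (inc-cong (suc f) n λ is → e _)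

inc-+ : ∀ f n (g h : Vec (Fin n) f → ℤ) → inc f n (λ is → g is + h is) ≡ inc f n g + inc f n h
inc-+ zero    n       g h = refl
inc-+ (suc f) zero    g h = refl
inc-+ (suc f) (suc n) g h = trans (cong₂ _+_ (inc-+ f n _ _) (inc-+ (suc f) n _ _))
  (interchange (inc f n (λ is → g (zero ∷ Vec.map suc is))) (inc f n (λ is → h (zero ∷ Vec.map suc is))) _ _)

cubeAt : ∀ {f} → (Point n → A) → Vec (Fin n) f → Point n → Cube A f
cubeAt S []       v = S v
cubeAt S (i ∷ is) v = cubeAt (double S i) is v

mapCube : ∀ f → (A → B) → Cube A f → Cube B f
mapCube zero    g = g
mapCube (suc f) g = mapCube f (map₂ g)

cubeAt-suc : ∀ {f} (S : Point (suc n) → A) (is : Vec (Fin n) f) b v →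
             cubeAt S (Vec.map suc is) (b ∷ v) ≡ cubeAt (S ∘ (b ∷_)) is v
cubeAt-suc S []       b v = refl
cubeAt-suc S (i ∷ is) b v = cubeAt-suc (double S (suc i)) is b v

cubeAt-map : ∀ {f} (g : A → B) (S : Point n → A) (is : Vec (Fin n) f) v →
             cubeAt (g ∘ S) is v ≡ mapCube f g (cubeAt S is v)
cubeAt-map g S []       v = refl
cubeAt-map g S (i ∷ is) v = cubeAt-map (map₂ g) (double S i) is v

TranslationInvariant : ∀ {A} f → (Cube A f → ℤ) → Set
TranslationInvariant         zero    Φ = ⊤
TranslationInvariant {A = A} (suc f) Φ = (∀ c → Φ (mapCube f swap c) ≡ Φ c) × TranslationInvariant {A = A × A} f Φ

-- A subcube with `f` flip bits has one increasing sequence of directions and 2^f base points, all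
-- of which give `Φ` the same value by translation invariance.
inc≡restrict : ∀ f n (S : Point n → A) (Φ : Cube A f → ℤ) → TranslationInvariant f Φ →
  inc f n (λ is → ∑ (allPoints n) λ v → Φ (cubeAt S is v)) ≡ + (2 ℕ.^ f) * ∑ (allPatterns n) (restrict f S Φ)
inc≡restrict zero zero S Φ _ = trans (∑-∷ [] [] _) (trans (cong (_+_ (Φ (S []))) (trans (∑-[] _) (sym (∑-[] _))))
  (trans (sym (∑-∷ [] [] (restrict zero S Φ))) (sym (*-identityˡ _))))
inc≡restrict (suc f) zero S Φ _ = sym (trans (cong (_*_ (+ (2 ℕ.^ suc f))) (trans (∑-∷ [] [] (restrict (suc f) S Φ))
  (trans (+-identityˡ _) (∑-[] _)))) (*-zeroʳ (+ (2 ℕ.^ suc f))))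
inc≡restrict zero (suc n) S Φ inv = begin
  ∑ (allPoints (suc n)) (Φ ∘ S)                                     ≡⟨ ∑-allPoints n (Φ ∘ S) ⟩
  ∑ (allPoints n) (λ v → Φ (S (false ∷ v)) + Φ (S (true ∷ v)))      ≡⟨ ∑-+ (allPoints n) _ _ ⟩
  ∑ (allPoints n) (λ v → Φ (S (false ∷ v))) + ∑ (allPoints n) (λ v → Φ (S (true ∷ v)))
    ≡⟨ cong₂ _+_ (inc≡restrict zero n (S ∘ (false ∷_)) Φ inv) (inc≡restrict zero n (S ∘ (true ∷_)) Φ inv) ⟩
  + 1 * X₁ + + 1 * X₂                                               ≡⟨ sym (*-distribˡ-+ (+ 1) X₁ X₂) ⟩
  + 1 * (X₁ + X₂)                                                   ≡⟨ cong (+ 1 *_) (sym (+-identityˡ (X₁ + X₂))) ⟩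
  + 1 * (0ℤ + (X₁ + X₂))                                            ≡⟨ cong (λ z → + 1 * (z + (X₁ + X₂))) (sym (∑-zero (allPatterns n))) ⟩
  + 1 * (∑ (allPatterns n) (λ _ → 0ℤ) + (X₁ + X₂))                  ≡⟨ cong (+ 1 *_) (sym (∑-allPatterns n (restrict zero S Φ))) ⟩
  + 1 * ∑ (allPatterns (suc n)) (restrict zero S Φ)                 ∎
  where
  open ≡-Reasoning
  X₁ = ∑ (allPatterns n) (restrict zero (S ∘ (false ∷_)) Φ)
  X₂ = ∑ (allPatterns n) (restrict zero (S ∘ (true ∷_)) Φ)
inc≡restrict {A = A} (suc f) (suc n) S Φ (inv , invs) = begin
  inc f n (λ is → h (zero ∷ Vec.map suc is)) + inc (suc f) n (λ is → h (Vec.map suc is))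
    ≡⟨ cong₂ _+_ first second ⟩
  + (2 ℕ.^ suc f) * X₀ + + (2 ℕ.^ suc f) * (X₁ + X₂)
    ≡⟨ sym (*-distribˡ-+ (+ (2 ℕ.^ suc f)) X₀ (X₁ + X₂)) ⟩
  + (2 ℕ.^ suc f) * (X₀ + (X₁ + X₂))
    ≡⟨ cong (+ (2 ℕ.^ suc f) *_) (sym (∑-allPatterns n (restrict (suc f) S Φ))) ⟩
  + (2 ℕ.^ suc f) * ∑ (allPatterns (suc n)) (restrict (suc f) S Φ) ∎
  where
  open ≡-Reasoning
  P : Point n → A × A
  P u = S (false ∷ u) , S (true ∷ u)
  X₀ = ∑ (allPatterns n) (restrict f P Φ)
  X₁ = ∑ (allPatterns n) (restrict (suc f) (S ∘ (false ∷_)) Φ)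
  X₂ = ∑ (allPatterns n) (restrict (suc f) (S ∘ (true ∷_)) Φ)
  h : Vec (Fin (suc n)) (suc f) → ℤ
  h is = ∑ (allPoints (suc n)) λ v → Φ (cubeAt S is v)
  g : Vec (Fin n) f → ℤ
  g is = ∑ (allPoints n) λ v → Φ (cubeAt P is v)
  -- Base points with first coordinate 0 and 1 see the same cube up to a swap in the first
  -- direction, hence two equal halves.
  split : ∀ is → h (zero ∷ Vec.map suc is) ≡ g is + g is
  split is = trans (∑-allPoints n _) (trans (∑-+ (allPoints n) _ _) (cong₂ _+_
    (∑-cong (allPoints n) λ v → cong Φ (cubeAt-suc (double S zero) is false v))
    (∑-cong (allPoints n) λ v → trans (cong Φ (trans (cubeAt-suc (double S zero) is true v) (cubeAt-map swap P is v))) (inv (cubeAt P is v)))))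
  first : inc f n (λ is → h (zero ∷ Vec.map suc is)) ≡ + (2 ℕ.^ suc f) * X₀
  first = trans (inc-cong f n split) (trans (inc-+ f n g g) (trans (cong₂ _+_ ih ih)
    (trans (sym (*-distribʳ-+ X₀ (+ (2 ℕ.^ f)) (+ (2 ℕ.^ f)))) (cong (λ m → + (2 ℕ.^ f ℕ.+ m) * X₀) (sym (ℕ.+-identityʳ (2 ℕ.^ f)))))))
    where
    ih = inc≡restrict f n P Φ invs
  second : inc (suc f) n (λ is → h (Vec.map suc is)) ≡ + (2 ℕ.^ suc f) * (X₁ + X₂)
  second = trans (inc-cong (suc f) n λ is → trans (∑-allPoints n _) (trans (∑-+ (allPoints n) _ _) (cong₂ _+_
      (∑-cong (allPoints n) λ v → cong Φ (cubeAt-suc S is false v)) (∑-cong (allPoints n) λ v → cong Φ (cubeAt-suc S is true v)))))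
    (trans (inc-+ (suc f) n _ _) (trans (cong₂ _+_ (inc≡restrict (suc f) n (S ∘ (false ∷_)) Φ (inv , invs))
      (inc≡restrict (suc f) n (S ∘ (true ∷_)) Φ (inv , invs))) (sym (*-distribˡ-+ (+ (2 ℕ.^ suc f)) X₁ X₂))))

nC0≡1 : ∀ n → n C 0 ≡ 1
nC0≡1 n = trans (nCk≡nC[n∸k] {0} {n} ℕ.z≤n) (nCn≡1 n)

∑-restrict-1 : ∀ f n (S : Point n → A) → ∑ (allPatterns n) (restrict f S (λ _ → 1ℤ)) ≡ + ((n C f) ℕ.* 2 ℕ.^ (n ℕ.∸ f))
∑-restrict-1 zero    zero    S = trans (∑-∷ [] [] _) (cong (_+_ 1ℤ) (∑-[] _))
∑-restrict-1 (suc f) zero    S = trans (∑-∷ [] [] (restrict (suc f) S (λ _ → 1ℤ))) (trans (+-identityˡ _)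
  (trans (∑-[] _) (cong (λ m → + (m ℕ.* 1)) (sym (k>n⇒nCk≡0 {0} {suc f} (ℕ.s≤s ℕ.z≤n))))))
∑-restrict-1 zero    (suc n) S = begin
  ∑ (allPatterns (suc n)) (restrict zero S (λ _ → 1ℤ))         ≡⟨ ∑-allPatterns n (restrict zero S (λ _ → 1ℤ)) ⟩
  ∑ (allPatterns n) (λ _ → 0ℤ) + _
    ≡⟨ cong₂ _+_ (∑-zero (allPatterns n)) (cong₂ _+_ (∑-restrict-1 zero n (S ∘ (false ∷_))) (∑-restrict-1 zero n (S ∘ (true ∷_)))) ⟩
  0ℤ + + ((n C 0) ℕ.* 2 ℕ.^ n ℕ.+ (n C 0) ℕ.* 2 ℕ.^ n)             ≡⟨ +-identityˡ (+ ((n C 0) ℕ.* 2 ℕ.^ n ℕ.+ (n C 0) ℕ.* 2 ℕ.^ n)) ⟩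
  + ((n C 0) ℕ.* 2 ℕ.^ n ℕ.+ (n C 0) ℕ.* 2 ℕ.^ n)                  ≡⟨ cong (λ m → + m) (eq (2 ℕ.^ n) (n C 0) (suc n C 0) (nC0≡1 n) (nC0≡1 (suc n))) ⟩
  + ((suc n C 0) ℕ.* 2 ℕ.^ suc n)                                ∎
  where
  open ≡-Reasoning
  eq : ∀ m a b → a ≡ 1 → b ≡ 1 → a ℕ.* m ℕ.+ a ℕ.* m ≡ b ℕ.* (2 ℕ.* m)
  eq m _ _ refl refl = sym (trans (ℕ.*-identityˡ (2 ℕ.* m)) (cong₂ ℕ._+_ (sym (ℕ.*-identityˡ m)) refl))
∑-restrict-1 (suc f) (suc n) S = trans (∑-allPatterns n _) (trans (cong₂ _+_ (∑-restrict-1 f n _)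
    (cong₂ _+_ (∑-restrict-1 (suc f) n (S ∘ (false ∷_))) (∑-restrict-1 (suc f) n (S ∘ (true ∷_)))))
  (cong (λ m → + m) pascal))
  where
  open ≡-Reasoning
  double-power : (n C suc f) ℕ.* 2 ℕ.^ (n ℕ.∸ suc f) ℕ.+ (n C suc f) ℕ.* 2 ℕ.^ (n ℕ.∸ suc f) ≡ (n C suc f) ℕ.* 2 ℕ.^ (n ℕ.∸ f)
  double-power with suc f ℕ.≤? n
  ... | yes p = trans (sym (ℕ.*-distribˡ-+ (n C suc f) m m)) (cong ((n C suc f) ℕ.*_)
                  (trans (cong (m ℕ.+_) (sym (ℕ.+-identityʳ m))) (cong (2 ℕ.^_) (sym (ℕ.+-∸-assoc 1 p)))))
    where m = 2 ℕ.^ (n ℕ.∸ suc f)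
  -- Here truncated subtraction breaks the doubling of the power, but the binomial coefficient is 0.
  ... | no p rewrite k>n⇒nCk≡0 (ℕ.≰⇒> p) = refl
  pascal : (n C f) ℕ.* 2 ℕ.^ (n ℕ.∸ f) ℕ.+ ((n C suc f) ℕ.* 2 ℕ.^ (n ℕ.∸ suc f) ℕ.+ (n C suc f) ℕ.* 2 ℕ.^ (n ℕ.∸ suc f))
         ≡ (suc n C suc f) ℕ.* 2 ℕ.^ (n ℕ.∸ f)
  pascal = trans (cong ((n C f) ℕ.* 2 ℕ.^ (n ℕ.∸ f) ℕ.+_) double-power)
    (trans (sym (ℕ.*-distribʳ-+ (2 ℕ.^ (n ℕ.∸ f)) (n C f) (n C suc f))) (cong (ℕ._* 2 ℕ.^ (n ℕ.∸ f)) (nCk+nC[k+1]≡[n+1]C[k+1] n f)))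

uncurry₂ : (Fin n → Fin n → ℤ) → Vec (Fin n) 2 → ℤ
uncurry₂ G (i ∷ j ∷ []) = G i j

uncurry₃ : (Fin n → Fin n → Fin n → ℤ) → Vec (Fin n) 3 → ℤ
uncurry₃ H (i ∷ j ∷ k ∷ []) = H i j k

inc₁ : ∀ n (h : Vec (Fin n) 1 → ℤ) → inc 1 n h ≡ ∑ (allFin n) (λ i → h (i ∷ []))
inc₁ zero    h = sym (∑-[] _)
inc₁ (suc n) h = trans (cong (_+_ (h (zero ∷ []))) (inc₁ n _)) (sym (∑-allFin n (λ i → h (i ∷ []))))

drop-zero : ∀ n (f : Fin (suc n) → ℤ) → 0ℤ ≤ f zero → ∑ (allFin n) (f ∘ suc) ≤ ∑ (allFin (suc n)) f
drop-zero n f p = subst₂ _≤_ (+-identityˡ _) (sym (∑-allFin n f)) (+-monoˡ-≤ (∑ (allFin n) (f ∘ suc)) p)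

-- Each increasing pair occurs in two orders; the diagonal is nonnegative and is dropped.
2*inc≤ : ∀ n (G : Fin n → Fin n → ℤ) → (∀ i j → G i j ≡ G j i) → (∀ i j → 0ℤ ≤ G i j) →
         + 2 * inc 2 n (uncurry₂ G) ≤ ∑ (allFin n) λ i → ∑ (allFin n) (G i)
2*inc≤ zero    G s p = ≤-reflexive (sym (∑-[] _))
2*inc≤ (suc n) G s p = begin
  + 2 * inc 2 (suc n) (uncurry₂ G)
    ≡⟨ cong (+ 2 *_) (cong₂ _+_ (inc₁ n _) (inc-cong 2 n λ { (i ∷ j ∷ []) → refl })) ⟩
  + 2 * (a + x)                                               ≡⟨ eq a x ⟩
  0ℤ + (a + (a + + 2 * x))                                    ≤⟨ +-mono-≤ (p zero zero) (+-monoʳ-≤ a (+-monoʳ-≤ a ih)) ⟩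
  G zero zero + (a + (a + b))                                 ≡⟨ sym (+-assoc (G zero zero) a (a + b)) ⟩
  (G zero zero + a) + (a + b)
    ≡⟨ cong₂ _+_ (sym (∑-allFin n (G zero))) (trans (cong (_+ b) (∑-cong (allFin n) λ i → s zero (suc i)))
         (trans (sym (∑-+ (allFin n) _ _)) (∑-cong (allFin n) λ i → sym (∑-allFin n (G (suc i)))))) ⟩
  ∑ (allFin (suc n)) (G zero) + ∑ (allFin n) (λ i → ∑ (allFin (suc n)) (G (suc i)))
    ≡⟨ sym (∑-allFin n (λ i → ∑ (allFin (suc n)) (G i))) ⟩
  ∑ (allFin (suc n)) (λ i → ∑ (allFin (suc n)) (G i))         ∎
  where
  open ≤-Reasoning
  open +-*-Solver
  G′ : Fin n → Fin n → ℤ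
  G′ i j = G (suc i) (suc j)
  a = ∑ (allFin n) λ j → G zero (suc j)
  b = ∑ (allFin n) λ i → ∑ (allFin n) (G′ i)
  x = inc 2 n (uncurry₂ G′)
  ih : + 2 * x ≤ b
  ih = 2*inc≤ n G′ (λ i j → s (suc i) (suc j)) (λ i j → p (suc i) (suc j))
  eq : ∀ a x → + 2 * (a + x) ≡ 0ℤ + (a + (a + + 2 * x))
  eq = solve 2 (λ a x → con (+ 2) :* (a :+ x) := con 0ℤ :+ (a :+ (a :+ con (+ 2) :* x))) refl

-- In the induction, direction `zero` can stand in any of three positions, each leaving a symmetric
-- sum over pairs, where `2*inc≤` applies: 3 · 2 = 6 orders. Triples with `zero` repeated are
-- dropped.
6*inc≤ : ∀ n (H : Fin n → Fin n → Fin n → ℤ) → (∀ i j k → H i j k ≡ H j i k) → (∀ i j k → H i j k ≡ H i k j) →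
         (∀ i j k → 0ℤ ≤ H i j k) →
         + 6 * inc 3 n (uncurry₃ H) ≤ ∑ (allFin n) λ i → ∑ (allFin n) λ j → ∑ (allFin n) (H i j)
6*inc≤ zero    H s₁ s₂ p = ≤-reflexive (sym (∑-[] _))
6*inc≤ (suc n) H s₁ s₂ p = begin
  + 6 * inc 3 (suc n) (uncurry₃ H)
    ≡⟨ cong (+ 6 *_) (cong₂ _+_ (inc-cong 2 n λ { (i ∷ j ∷ []) → refl }) (inc-cong 3 n λ { (i ∷ j ∷ k ∷ []) → refl })) ⟩
  + 6 * (x + y)                                               ≡⟨ eq x y ⟩
  + 2 * x + (+ 2 * x + (+ 2 * x + + 6 * y))
    ≤⟨ +-mono-≤ two (+-mono-≤ two (+-mono-≤ two (6*inc≤ n (λ i j k → H (suc i) (suc j) (suc k))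
         (λ i j k → s₁ (suc i) (suc j) (suc k)) (λ i j k → s₂ (suc i) (suc j) (suc k)) (λ i j k → p (suc i) (suc j) (suc k))))) ⟩
  b + (b + (b + b₃))                                           ≤⟨ +-mono-≤ first rest ⟩
  ∑∑ (H zero) + ∑ (allFin n) (λ i → ∑∑ (H (suc i)))           ≡⟨ sym (∑-allFin n (λ i → ∑∑ (H i))) ⟩
  ∑ (allFin (suc n)) (λ i → ∑∑ (H i))                         ∎
  where
  open ≤-Reasoning
  open +-*-Solver
  ∑∑ : (Fin (suc n) → Fin (suc n) → ℤ) → ℤ
  ∑∑ G = ∑ (allFin (suc n)) λ j → ∑ (allFin (suc n)) (G j)
  H₀ : Fin n → Fin n → ℤ
  H₀ j k = H zero (suc j) (suc k)
  x = inc 2 n (uncurry₂ H₀)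
  y = inc 3 n (uncurry₃ λ i j k → H (suc i) (suc j) (suc k))
  b = ∑ (allFin n) λ j → ∑ (allFin n) (H₀ j)
  b₃ = ∑ (allFin n) λ i → ∑ (allFin n) λ j → ∑ (allFin n) λ k → H (suc i) (suc j) (suc k)
  two : + 2 * x ≤ b
  two = 2*inc≤ n H₀ (λ j k → s₂ zero (suc j) (suc k)) (λ j k → p zero (suc j) (suc k))
  first : b ≤ ∑∑ (H zero)
  first = ≤-trans (∑-mono (allFin n) λ j → drop-zero n (H zero (suc j)) (p zero (suc j) zero))
    (drop-zero n (λ j → ∑ (allFin (suc n)) (H zero j)) (∑-nonneg _ λ k → p zero zero k))
  rest : b + (b + b₃) ≤ ∑ (allFin n) λ i → ∑∑ (H (suc i))
  rest = begin
    b + (b + b₃)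
      ≡⟨ cong₂ (λ u w → u + (w + b₃)) (∑-cong (allFin n) λ i → ∑-cong (allFin n) λ k → s₁ zero (suc i) (suc k))
           (∑-cong (allFin n) λ i → ∑-cong (allFin n) λ j → trans (s₁ zero (suc i) (suc j)) (s₂ (suc i) zero (suc j))) ⟩
    b₁ + (b₂ + b₃)
      ≡⟨ cong (_+_ b₁) (trans (sym (∑-+ (allFin n) _ _)) (∑-cong (allFin n) λ i → trans (sym (∑-+ (allFin n) _ _))
           (∑-cong (allFin n) λ j → sym (∑-allFin n (H (suc i) (suc j)))))) ⟩
    b₁ + ∑ (allFin n) (λ i → ∑ (allFin n) λ j → ∑ (allFin (suc n)) (H (suc i) (suc j)))
      ≤⟨ +-monoˡ-≤ _ (∑-mono (allFin n) λ i → drop-zero n (H (suc i) zero) (p (suc i) zero zero)) ⟩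
    ∑ (allFin n) (λ i → ∑ (allFin (suc n)) (H (suc i) zero)) + _
      ≡⟨ trans (sym (∑-+ (allFin n) _ _)) (∑-cong (allFin n) λ i → sym (∑-allFin n (λ j → ∑ (allFin (suc n)) (H (suc i) j)))) ⟩
    ∑ (allFin n) (λ i → ∑∑ (H (suc i)))                       ∎
    where
    b₁ = ∑ (allFin n) λ i → ∑ (allFin n) λ k → H (suc i) zero (suc k)
    b₂ = ∑ (allFin n) λ i → ∑ (allFin n) λ j → H (suc i) (suc j) zero
  eq : ∀ x y → + 6 * (x + y) ≡ + 2 * x + (+ 2 * x + (+ 2 * x + + 6 * y))
  eq = solve 2 (λ x y → con (+ 6) :* (x :+ y) := con (+ 2) :* x :+ (con (+ 2) :* x :+ (con (+ 2) :* x :+ con (+ 6) :* y))) refl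

module DoubleCount (p : Cube₃ → Bool)
  (p-symmetric : Symmetric p) {n : ℕ} (S : Config n) where

  open Averages S
  open Multiples S

  open Symmetric p-symmetric

  private
    Φ : Cube₃ → ℤ
    Φ x = + bit (p x)

    lift : ∀ {x y} → p x ≡ p y → Φ x ≡ Φ y
    lift = cong λ b → + bit b

    H : Fin n → Fin n → Fin n → ℤ
    H i j k = ∑ (allPoints n) λ v → Φ (cube₃ i j k v)

  48*∑restrict≤E₃ : + 48 * ∑ (allPatterns n) (restrict 3 S λ x → + bit (p x)) ≤ E₃ λ x → + bit (p x)
  48*∑restrict≤E₃ = begin
    + 48 * ∑ (allPatterns n) (restrict 3 S Φ)               ≡⟨ *-assoc (+ 6) (+ 8) (∑ (allPatterns n) (restrict 3 S Φ)) ⟩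
    + 6 * (+ 8 * ∑ (allPatterns n) (restrict 3 S Φ))        ≡⟨ cong (+ 6 *_) (sym (inc≡restrict 3 n S Φ ((λ x → lift (sym-u₁ x)) , (λ x → lift (sym-u₂ x)) , (λ x → lift (sym-u₃ x)) , tt))) ⟩
    + 6 * inc 3 n (λ is → ∑ (allPoints n) λ v → Φ (cubeAt S is v))
                                                            ≡⟨ cong (+ 6 *_) (inc-cong 3 n λ { (i ∷ j ∷ k ∷ []) → refl }) ⟩
    + 6 * inc 3 n (uncurry₃ H)                              ≤⟨ 6*inc≤ n H sym₁ sym₂ (λ i j k → ∑-nonneg _ λ v → +≤+ ℕ.z≤n) ⟩
    ∑ Ds (λ i → ∑ Ds λ j → ∑ Ds (H i j))                    ≡⟨ sym reorder ⟩
    E₃ Φ                                                    ∎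
    where
    open ≤-Reasoning
    sym₁ : ∀ i j k → H i j k ≡ H j i k
    sym₁ i j k = ∑-cong _ λ v → trans (cong Φ (double-map₂ (cube₂ j i) (cube₂ i j) transpose (double-transpose S j i) k v)) (lift (sym-p₁₂ (cube₃ j i k v)))
    sym₂ : ∀ i j k → H i j k ≡ H i k j
    sym₂ i j k = ∑-cong _ λ v → trans (cong Φ (double-transpose (double S i) k j v)) (lift (sym-p₂₃ (cube₃ i k j v)))
    reorder : E₃ Φ ≡ ∑ Ds λ i → ∑ Ds λ j → ∑ Ds (H i j)
    reorder = trans (∑-swap _ Ds _) (∑-cong Ds λ i → trans (∑-swap _ Ds _) (∑-cong Ds λ j → ∑-swap _ Ds _))

length-allPoints : ∀ n → length (allPoints n) ≡ 2 ℕ.^ n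
length-allPoints n = +-injective (trans (sym (trans (∑-const (allPoints n) 1ℤ) (*-identityʳ _))) (go n))
  where
  go : ∀ n → ∑ (allPoints n) (λ _ → 1ℤ) ≡ + (2 ℕ.^ n)
  go zero    = trans (∑-∷ [] [] _) (cong (_+_ 1ℤ) (∑-[] _))
  go (suc n) = trans (∑-allPoints n _) (trans (∑-+ (allPoints n) _ _) (trans (cong₂ _+_ (go n) (go n))
    (cong (λ m → + (2 ℕ.^ n ℕ.+ m)) (sym (ℕ.+-identityʳ (2 ℕ.^ n))))))

E₃-1 : ∀ {n} (S : Config n) → Multiples.E₃ S (λ _ → 1ℤ) ≡ + (2 ℕ.^ n ℕ.* (n ℕ.* (n ℕ.* n)))
E₃-1 {n} S = trans (∑-cong (allPoints n) λ v → trans (∑-cong (allFin n) λ i → trans (∑-cong (allFin n) λ j →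
      trans (con 1) (cong (λ m → + m) (ℕ.*-identityʳ n))) (con n)) (con (n ℕ.* n)))
    (trans (∑-const (allPoints n) _) (trans (cong (λ m → + m * + (n ℕ.* (n ℕ.* n))) (length-allPoints n)) (sym (pos-* (2 ℕ.^ n) _))))
  where
  con : ∀ m → ∑ (allFin n) (λ _ → + m) ≡ + (n ℕ.* m)
  con m = trans (∑-const (allFin n) (+ m)) (trans (cong (λ k → + k * + m) (length-tabulate {n = n} id)) (sym (pos-* n m)))

-- Copies in a subcube

any-sound : (p : X → Bool) (xs : List X) → any p xs ≡ true → ∃ λ x → x ∈ xs × p x ≡ true
any-sound p (x ∷ xs) e = ∨-elim {a = p x} e (λ e → x , here refl , e)
  (λ e → let (y , y∈ , q) = any-sound p xs e in y , there y∈ , q)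

any-complete : (p : X → Bool) {xs : List X} {x : X} → x ∈ xs → p x ≡ true → any p xs ≡ true
any-complete p {x ∷ xs} (here refl) e rewrite e = refl
any-complete p {x ∷ xs} (there x∈)  e with p x
... | true  = refl
... | false = any-complete p x∈ e

all-sound : (p : X → Bool) {xs : List X} → all p xs ≡ true → ∀ {x} → x ∈ xs → p x ≡ true
all-sound p {x ∷ xs} e (here refl) = proj₁ (∧-≡ e)
all-sound p {x ∷ xs} e (there x∈)  = all-sound p (proj₂ (∧-≡ {p x} e)) x∈

all-complete : (p : X → Bool) (xs : List X) → (∀ {x} → x ∈ xs → p x ≡ true) → all p xs ≡ true
all-complete p []       h = refl
all-complete p (x ∷ xs) h rewrite h (here refl) = all-complete p xs (h ∘ there)

∧-true : ∀ {a b} → a ≡ true → b ≡ true → a ∧ b ≡ true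
∧-true refl refl = refl

boolEq-complete : ∀ {a b} → a ≡ b → boolEq a b ≡ true
boolEq-complete {true}  refl = refl
boolEq-complete {false} refl = refl

eqP-sound : (u v : Point n) → eqP u v ≡ true → u ≡ v
eqP-sound []      []      e = refl
eqP-sound (a ∷ u) (b ∷ v) e = cong₂ _∷_ (boolEq-sound (proj₁ (∧-≡ e))) (eqP-sound u v (proj₂ (∧-≡ {boolEq a b} e)))

eqP-refl : (u : Point n) → eqP u u ≡ true
eqP-refl []      = refl
eqP-refl (a ∷ u) = ∧-true (boolEq-complete {a} refl) (eqP-refl u)

∈-allPoints : (v : Point n) → v ∈ allPoints n
∈-allPoints []          = here refl
∈-allPoints (false ∷ v) = ∈-concatMap⁺ _ (lose (∈-allPoints v) (here refl))
∈-allPoints (true ∷ v)  = ∈-concatMap⁺ _ (lose (∈-allPoints v) (there (here refl)))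

allFuns-complete : ∀ d (bs : List B) (h : Point d → B) → (∀ x → h x ∈ bs) →
                   ∃ λ f → f ∈ allFuns d bs × (∀ x → f x ≡ h x)
allFuns-complete zero    bs h h∈ = _ , ∈-map⁺ _ (h∈ []) , λ { [] → refl }
allFuns-complete (suc d) bs h h∈ =
  let (f , f∈ , fe) = allFuns-complete d bs (h ∘ (false ∷_)) (h∈ ∘ (false ∷_))
      (g , g∈ , ge) = allFuns-complete d bs (h ∘ (true ∷_)) (h∈ ∘ (true ∷_))
  in _ , ∈-concatMap⁺ _ (lose f∈ (∈-map⁺ _ g∈)) , λ { (false ∷ v) → fe v ; (true ∷ v) → ge v }

allFuns-sound : ∀ d (bs : List B) → All (λ f → ∀ x → f x ∈ bs) (allFuns d bs)
allFuns-sound zero    bs = All.map⁺ (All.tabulate λ b∈ x → b∈)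
allFuns-sound (suc d) bs = All.concat⁺ (All.map⁺ (All.map (λ fs → All.map⁺ (All.map (λ gs →
  λ { (false ∷ v) → fs v ; (true ∷ v) → gs v }) (allFuns-sound d bs))) (allFuns-sound d bs)))

-- Coordinates on a subcube, carrying what both `givesCopy` and `restrict` see of it. The dimension
-- is an index separate from `flips c` so that it can be transported to 3.
record Chart (c : Pattern n) (S : Point n → A) (k : ℕ) : Set₁ where
  field
    embed      : Point k → Point n
    induced    : Cube A k
    points     : cubePoints c ≡ map embed (allPoints k)
    embed-eqP  : ∀ x y → eqP (embed x) (embed y) ≡ eqP x y
    embed-dist : ∀ x y → dist (embed x) (embed y) ≡ dist x y
    induced-at : ∀ x → at {k = k} induced x ≡ S (embed x)
    restrict≡  : ∀ Φ → restrict k S Φ c ≡ Φ induced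

boolEq-refl : ∀ b → boolEq b b ≡ true
boolEq-refl b = boolEq-complete {b} refl

chart : (c : Pattern n) (S : Point n → A) → Chart c S (flips c)
chart [] S = record { embed = id ; induced = S [] ; points = refl ; embed-eqP = λ x y → refl
  ; embed-dist = λ x y → refl ; induced-at = λ { [] → refl } ; restrict≡ = λ Φ → refl }
chart (just b ∷ c) S = record
  { embed = λ x → b ∷ embed x ; induced = induced
  ; points = trans (cong (map (b ∷_)) points) (sym (map-∘ (allPoints (flips c))))
  ; embed-eqP = λ x y → trans (cong (_∧ eqP (embed x) (embed y)) (boolEq-refl b)) (embed-eqP x y)
  ; embed-dist = λ x y → trans (cong (λ e → (if e then 0 else 1) ℕ.+ dist (embed x) (embed y)) (boolEq-refl b)) (embed-dist x y)
  ; induced-at = induced-at ; restrict≡ = λ Φ → trans (step (flips c) Φ) (restrict≡ Φ) }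
  where
  open Chart (chart c (S ∘ (b ∷_)))
  step : ∀ f Φ → restrict f S Φ (just b ∷ c) ≡ restrict f (S ∘ (b ∷_)) Φ c
  step zero    Φ = refl
  step (suc f) Φ = refl
chart (nothing ∷ c) S = record
  { embed = λ { (b ∷ x) → b ∷ embed x } ; induced = induced
  ; points = trans (cong (concatMap _) points) (trans (concatMap-map _ _ (allPoints (flips c)))
      (sym (map-concatMap _ _ (allPoints (flips c)))))
  ; embed-eqP = λ { (a ∷ x) (b ∷ y) → cong (boolEq a b ∧_) (embed-eqP x y) }
  ; embed-dist = λ { (a ∷ x) (b ∷ y) → cong ((if boolEq a b then 0 else 1) ℕ.+_) (embed-dist x y) }
  ; induced-at = λ { (false ∷ x) → cong proj₁ (induced-at x) ; (true ∷ x) → cong proj₂ (induced-at x) }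
  ; restrict≡ = restrict≡ }
  where open Chart (chart c (λ u → S (false ∷ u) , S (true ∷ u)))

restrict≡0 : ∀ f (S : Point n → A) Φ (c : Pattern n) → flips c ≢ f → restrict f S Φ c ≡ 0ℤ
restrict≡0 zero    S Φ []            ne = ⊥-elim (ne refl)
restrict≡0 (suc f) S Φ []            ne = refl
restrict≡0 zero    S Φ (just b ∷ c)  ne = restrict≡0 zero (S ∘ (b ∷_)) Φ c ne
restrict≡0 (suc f) S Φ (just b ∷ c)  ne = restrict≡0 (suc f) (S ∘ (b ∷_)) Φ c ne
restrict≡0 zero    S Φ (nothing ∷ c) ne = refl
restrict≡0 (suc f) S Φ (nothing ∷ c) ne = restrict≡0 f _ Φ c (ne ∘ cong suc)

compatible : Point 3 × Point 3 → Point 3 × Point 3 → Bool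
compatible (x , x′) (y , y′) = boolEq (eqP x y) (eqP x′ y′) ∧ boolEq (adj x y) (adj x′ y′)

-- Backtracking over all partial adjacency preserving maps: each of them extends to an automorphism in the list.
extensible : List (Point 3) → List (Point 3 × Point 3) → Bool
extensible []       ps = any (λ f → all (λ { (x , y) → eqP (f x) y }) ps) automorphisms
extensible (x ∷ xs) ps = all (λ y → all (λ p → compatible p (x , y)) ps ⇒ extensible xs ((x , y) ∷ ps)) (allPoints 3)

module _ (ψ : Point 3 → Point 3) (ψ-compatible : ∀ x y → compatible (x , ψ x) (y , ψ y) ≡ true) where

  private
    graph : Point 3 → Point 3 × Point 3
    graph x = x , ψ x

  -- The search accepts only if every admissible branch does, in particular the branch that assigns
  -- `ψ x` to each `x`; the automorphism found at its leaf agrees with `ψ`.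
  extensible-sound : ∀ xs zs → extensible xs (map graph zs) ≡ true →
    ∃ λ f → f ∈ automorphisms × (∀ {x} → x ∈ xs → f x ≡ ψ x) × (∀ {z} → z ∈ zs → f z ≡ ψ z)
  extensible-sound [] zs e =
    let (f , f∈ , q) = any-sound (λ f → all (λ { (x , y) → eqP (f x) y }) (map graph zs)) automorphisms e
    in f , f∈ , (λ ()) , λ {z} z∈ → eqP-sound (f z) (ψ z) (all-sound (λ { (x , y) → eqP (f x) y }) q (∈-map⁺ graph z∈))
  extensible-sound (x ∷ xs) zs e =
    let (f , f∈ , p , q) = extensible-sound xs (x ∷ zs) (⇒-elim
          (all-sound (λ y → all (λ p → compatible p (x , y)) (map graph zs) ⇒ extensible xs ((x , y) ∷ map graph zs))
            {allPoints 3} e (∈-allPoints (ψ x)))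
          (all-complete (λ p → compatible p (x , ψ x)) (map graph zs) λ {p} p∈ → compat p p∈))
    in f , f∈ , (λ { (here refl) → q (here refl) ; (there x∈) → p x∈ }) , q ∘ there
    where
    compat : ∀ p → p ∈ map graph zs → compatible p (x , ψ x) ≡ true
    compat p p∈ with ∈-map⁻ graph p∈
    ... | z , _ , refl = ψ-compatible z x

  automorphism : ∃ λ f → f ∈ automorphisms × (∀ x → f x ≡ ψ x)
  automorphism = let (f , f∈ , p , _) = extensible-sound (allPoints 3) [] refl in f , f∈ , λ x → p (∈-allPoints x)

agrees-sound : ∀ {d} {H K : Config d} → agrees H K ≡ true → ∀ x → H x ≡ K x
agrees-sound {H = H} {K} e x = boolEq-sound (all-sound (λ x → boolEq (H x) (K x)) e (∈-allPoints x))

agrees-complete : ∀ {d} {H K : Config d} → (∀ x → H x ≡ K x) → agrees H K ≡ true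
agrees-complete {d} {H} {K} e = all-complete (λ x → boolEq (H x) (K x)) (allPoints d) λ {x} _ → boolEq-complete (e x)

preserves : ∀ {d} → (Point d → Point n) → Point d → Point d → Bool
preserves f x y = boolEq (eqP x y) (eqP (f x) (f y)) ∧ boolEq (adj x y) (adj (f x) (f y))

isIso-sound : ∀ {d} {c : Pattern n} {f : Point d → Point n} → isIso c f ≡ true →
  (∀ x y → preserves f x y ≡ true) × (∀ {p} → p ∈ cubePoints c → ∃ λ x → f x ≡ p)
isIso-sound {d = d} {c} {f} e =
  (λ x y → all-sound (preserves f x) (all-sound (λ x → all (preserves f x) (allPoints d)) (proj₁ (∧-≡ e)) (∈-allPoints x)) (∈-allPoints y)) ,
  λ {p} p∈ → let (x , _ , q) = any-sound (λ x → eqP (f x) p) (allPoints d)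
                    (all-sound (λ p → any (λ x → eqP (f x) p) (allPoints d))
                      (proj₂ (∧-≡ {all (λ x → all (preserves f x) (allPoints d)) (allPoints d)} e)) p∈)
             in x , eqP-sound (f x) p q

isIso-complete : ∀ {d} {c : Pattern n} {f : Point d → Point n} → (∀ x y → preserves f x y ≡ true) →
  (∀ {p} → p ∈ cubePoints c → ∃ λ x → f x ≡ p) → isIso c f ≡ true
isIso-complete {d = d} {c} {f} pres onto = ∧-true
  (all-complete (λ x → all (preserves f x) (allPoints d)) (allPoints d) λ {x} _ →
    all-complete (preserves f x) (allPoints d) λ {y} _ → pres x y)
  (all-complete (λ p → any (λ x → eqP (f x) p) (allPoints d)) (cubePoints c) λ {p} p∈ →
    let (x , q) = onto p∈ in any-complete (λ x → eqP (f x) p) (∈-allPoints x) (trans (cong (λ y → eqP y p) q) (eqP-refl p)))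

givesCopy-sound : ∀ {d} {H : Config d} {S : Config n} {c : Pattern n} → givesCopy H S c ≡ true →
  ∃ λ f → f ∈ allFuns d (cubePoints c) × isIso c f ≡ true × (∀ x → H x ≡ S (f x))
givesCopy-sound {d = d} {H} {S} {c} e =
  let (f , f∈ , q) = any-sound (λ f → isIso c f ∧ agrees H (S ∘ f)) (allFuns d (cubePoints c)) e
      (q₁ , q₂) = ∧-≡ {isIso c f} q
  in f , f∈ , q₁ , agrees-sound {H = H} {S ∘ f} q₂

givesCopy-complete : ∀ {d} {H : Config d} {S : Config n} {c : Pattern n} {f} → f ∈ allFuns d (cubePoints c) →
  isIso c f ≡ true → (∀ x → H x ≡ S (f x)) → givesCopy H S c ≡ true
givesCopy-complete {H = H} {S} {c} {f} f∈ iso e =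
  any-complete (λ f → isIso c f ∧ agrees H (S ∘ f)) f∈ (∧-true iso (agrees-complete {H = H} {S ∘ f} e))

-- Kept general in d: for d = 3 conversion checking would unfold the finite searches.
module _ {d} {c : Pattern n} {S : Config n} (ch : Chart c S d) (H : Config d) (fs : List (Point d → Point d)) where

  open Chart ch

  preserves-embed : (g : Point d → Point n) (f : Point d → Point d) → (∀ x → g x ≡ embed (f x)) →
                    ∀ x y → preserves g x y ≡ preserves f x y
  preserves-embed g f e x y = cong₂ (λ a b → boolEq (eqP x y) a ∧ boolEq (adj x y) (b ≡ᵇ 1))
    (trans (cong₂ eqP (e x) (e y)) (embed-eqP (f x) (f y))) (trans (cong₂ dist (e x) (e y)) (embed-dist (f x) (f y)))

  -- An automorphism `f` followed by `embed` is an isomorphism onto the subcube. The enumeration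
  -- contains it only up to pointwise equality, hence `g`.
  along⇒givesCopy : (∀ {f} → f ∈ fs → (∀ x y → preserves f x y ≡ true) × (∀ z → ∃ λ x → f x ≡ z)) →
    agreesAlong fs H (at {k = d} induced) ≡ true → givesCopy H S c ≡ true
  along⇒givesCopy aut e =
    let (f , f∈ , q) = any-sound (λ f → agrees H (at {k = d} induced ∘ f)) fs e
        (pres , onto) = aut f∈
        (g , g∈ , g≡) = allFuns-complete d (cubePoints c) (embed ∘ f)
          (λ x → subst (embed (f x) ∈_) (sym points) (∈-map⁺ embed (∈-allPoints (f x))))
    in givesCopy-complete {H = H} {S} {c} {g} g∈
      (isIso-complete {c = c} {g} (λ x y → trans (preserves-embed g f g≡ x y) (pres x y))
        λ {p} p∈ → let (z , _ , p≡) = ∈-map⁻ embed (subst (p ∈_) points p∈)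
                       (x , fx≡) = onto z
                   in x , trans (g≡ x) (trans (cong embed fx≡) (sym p≡)))
      λ x → trans (agrees-sound {H = H} {at {k = d} induced ∘ f} q x) (trans (induced-at (f x)) (cong S (sym (g≡ x))))

  -- Conversely, an isomorphism onto the subcube factors pointwise as `embed ∘ ψ`, and `ψ` preserves
  -- equality and adjacency because `embed` preserves `eqP` and `dist`.
  givesCopy⇒along : (∀ (ψ : Point d → Point d) → (∀ x y → preserves ψ x y ≡ true) → ∃ λ f → f ∈ fs × (∀ x → f x ≡ ψ x)) →
    givesCopy H S c ≡ true → agreesAlong fs H (at {k = d} induced) ≡ true
  givesCopy⇒along aut e =
    let (g , g∈ , iso , values) = givesCopy-sound {H = H} {S} {c} e
        preimage = λ x → ∈-map⁻ embed (subst (g x ∈_) points (All.lookup (allFuns-sound d (cubePoints c)) g∈ x))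
        ψ = λ x → proj₁ (preimage x)
        g≡ = λ x → proj₂ (proj₂ (preimage x))
        (f , f∈ , f≡) = aut ψ (λ x y → trans (sym (preserves-embed g ψ g≡ x y)) (proj₁ (isIso-sound {c = c} {g} iso) x y))
    in any-complete (λ f → agrees H (at {k = d} induced ∘ f)) f∈ (agrees-complete {H = H} {at {k = d} induced ∘ f}
      λ x → trans (values x) (trans (cong S (g≡ x)) (trans (sym (induced-at (ψ x))) (cong (at {k = d} induced) (sym (f≡ x))))))

-- The pattern with three flip bits is the whole 3-cube, so here `isIso` means being an
-- automorphism.
automorphisms-iso : all (isIso (nothing ∷ nothing ∷ nothing ∷ [])) automorphisms ≡ true
automorphisms-iso = refl

∈-cubePoints : (v : Point 3) → v ∈ cubePoints (nothing ∷ nothing ∷ nothing ∷ [])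
∈-cubePoints = ∈-allPoints

bool-iff : ∀ {a b} → (a ≡ true → b ≡ true) → (b ≡ true → a ≡ true) → a ≡ b
bool-iff {true}  {b}     p q = sym (p refl)
bool-iff {false} {true}  p q = q refl
bool-iff {false} {false} p q = refl

givesCopy≡isCopy : {c : Pattern n} {S : Config n} (ch : Chart c S 3) (H : Config 3) →
                   givesCopy H S c ≡ isCopy H (Chart.induced ch)
givesCopy≡isCopy ch H = bool-iff (givesCopy⇒along ch H automorphisms automorphism)
  (along⇒givesCopy ch H automorphisms λ {f} f∈ →
    let (pres , onto) = isIso-sound {c = nothing ∷ nothing ∷ nothing ∷ []} {f}
          (all-sound (isIso (nothing ∷ nothing ∷ nothing ∷ [])) {automorphisms} automorphisms-iso f∈)
    in pres , λ z → onto (∈-cubePoints z))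

-- The number of copies as a sum over all patterns

∑-filter : {P : X → Set} (P? : Decidable P) (xs : List X) (f : X → ℤ) →
           ∑ (filter P? xs) f ≡ ∑ xs (λ x → if does (P? x) then f x else 0ℤ)
∑-filter P? []       f = trans (∑-[] f) (sym (∑-[] _))
∑-filter P? (x ∷ xs) f with does (P? x) in p
... | true  = trans (∑-∷ x _ f) (trans (cong (_+_ (f x)) (∑-filter P? xs f))
                (sym (trans (∑-∷ x xs _) (cong (λ b → (if b then f x else 0ℤ) + rest) p))))
  where rest = ∑ xs λ x → if does (P? x) then f x else 0ℤ
... | false = trans (∑-filter P? xs f)
                (sym (trans (∑-∷ x xs _) (trans (cong (λ b → (if b then f x else 0ℤ) + rest) p) (+-identityˡ rest))))
  where rest = ∑ xs λ x → if does (P? x) then f x else 0ℤ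

length≡∑ : (xs : List X) → + length xs ≡ ∑ xs (λ _ → 1ℤ)
length≡∑ xs = sym (trans (∑-const xs 1ℤ) (*-identityʳ _))

copies : (Cube₃ → Bool) → Cube₃ → ℤ
copies p x = + bit (p x)

indicator : ∀ {P : Set} (P? : Dec P) b {z} → (P → + bit b ≡ z) → (¬ P → 0ℤ ≡ z) →
  (if does P? then (if does (b Bool.≟ true) then 1ℤ else 0ℤ) else 0ℤ) ≡ z
indicator (yes p) true  f g = f p
indicator (yes p) false f g = f p
indicator (no ¬p) b     f g = g ¬p

ΛS≡∑ : ∀ {d} (H : Config d) (S : Config n) → + ΛS H S ≡ ∑ (allPatterns n) λ c →
  if does (flips c ℕ.≟ d) then (if does (givesCopy H S c Bool.≟ true) then 1ℤ else 0ℤ) else 0ℤ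
ΛS≡∑ {n} {d} H S = trans (length≡∑ (filter (λ c → givesCopy H S c Bool.≟ true) (subcubes n d)))
  (trans (∑-filter (λ c → givesCopy H S c Bool.≟ true) (subcubes n d) _)
         (∑-filter (λ c → flips c ℕ.≟ d) (allPatterns n) _))

module _ (H : Config 3) (p : Cube₃ → Bool) (isCopy≡ : ∀ x → isCopy H x ≡ p x) where

  -- This makes the count a sum of one function of the induced 3-cubes, the form in which both
  -- bounds use it.
  ΛS≡∑restrict : (S : Config n) → + ΛS H S ≡ ∑ (allPatterns n) (restrict 3 S (copies p))
  ΛS≡∑restrict {n} S = trans (ΛS≡∑ H S) (∑-cong (allPatterns n) λ c → indicator (flips c ℕ.≟ 3) (givesCopy H S c)
    (λ e → trans (cong (λ b → + bit b) (trans (givesCopy≡isCopy (toChart c e) H) (isCopy≡ _))) (sym (Chart.restrict≡ (toChart c e) (copies p))))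
    (λ ne → sym (restrict≡0 3 S (copies p) c ne)))
    where
    toChart : ∀ c {k} → flips c ≡ k → Chart c S k
    toChart c refl = chart c S

-- Lower bounds by averaging

restrict-cong : ∀ f {S T : Point n → A} → (∀ v → S v ≡ T v) → ∀ Φ (c : Pattern n) → restrict f S Φ c ≡ restrict f T Φ c
restrict-cong zero    e Φ []            = cong Φ (e [])
restrict-cong (suc f) e Φ []            = refl
restrict-cong zero    e Φ (just b ∷ c)  = restrict-cong zero (λ v → e (b ∷ v)) Φ c
restrict-cong (suc f) e Φ (just b ∷ c)  = restrict-cong (suc f) (λ v → e (b ∷ v)) Φ c
restrict-cong zero    e Φ (nothing ∷ c) = refl
restrict-cong (suc f) e Φ (nothing ∷ c) = restrict-cong f (λ v → cong₂ _,_ (e (false ∷ v)) (e (true ∷ v))) Φ c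

restrict-map : ∀ f (g : A → B) (S : Point n → A) Φ (c : Pattern n) →
               restrict f (g ∘ S) Φ c ≡ restrict f S (Φ ∘ mapCube f g) c
restrict-map zero    g S Φ []            = refl
restrict-map (suc f) g S Φ []            = refl
restrict-map zero    g S Φ (just b ∷ c)  = restrict-map zero g (S ∘ (b ∷_)) Φ c
restrict-map (suc f) g S Φ (just b ∷ c)  = restrict-map (suc f) g (S ∘ (b ∷_)) Φ c
restrict-map zero    g S Φ (nothing ∷ c) = refl
restrict-map (suc f) g S Φ (nothing ∷ c) = restrict-map f (map₂ g) (λ u → S (false ∷ u) , S (true ∷ u)) Φ c

restrict-1 : ∀ f (S : Point n → A) (T : Point n → B) (c : Pattern n) → restrict f S (λ _ → 1ℤ) c ≡ restrict f T (λ _ → 1ℤ) c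
restrict-1 zero    S T []            = refl
restrict-1 (suc f) S T []            = refl
restrict-1 zero    S T (just b ∷ c)  = restrict-1 zero (S ∘ (b ∷_)) (T ∘ (b ∷_)) c
restrict-1 (suc f) S T (just b ∷ c)  = restrict-1 (suc f) (S ∘ (b ∷_)) (T ∘ (b ∷_)) c
restrict-1 zero    S T (nothing ∷ c) = refl
restrict-1 (suc f) S T (nothing ∷ c) = restrict-1 f _ _ c

words : List X → ∀ n → List (Vec X n)
words xs zero    = [] ∷ []
words xs (suc n) = concatMap (λ w → map (_∷ w) xs) (words xs n)

∑-words : (xs : List X) (h : Vec X (suc n) → ℤ) → ∑ (words xs (suc n)) h ≡ ∑ (words xs n) λ w → ∑ xs λ x → h (x ∷ w)
∑-words {n = n} xs h = trans (∑-concatMap _ (words xs n) h) (∑-cong (words xs n) λ w → ∑-map (_∷ w) xs h)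

total-count : List X → (X → ℕ) → ℕ
total-count []       f = 0
total-count (x ∷ xs) f = f x ℕ.+ total-count xs f

∑≡total-count : (xs : List X) (f : X → ℕ) → ∑ xs (λ x → + f x) ≡ + total-count xs f
∑≡total-count []       f = ∑-[] _
∑≡total-count (x ∷ xs) f = trans (∑-∷ x xs _) (cong (_+_ (+ f x)) (∑≡total-count xs f))

-- Each coordinate independently gets a random class a; a coordinate of class a set to 1 moves the state by act a.
-- Averaging over the classes and the initial state, every subcube sees the same distribution of configurations.
module Averaging {K Q : Set} (ks : List K) (qs : List Q) (act : K → Q → Q)
  (act-comm : ∀ a b q → act a (act b q) ≡ act b (act a q))
  (act-perm : ∀ a (f : Q → ℤ) → ∑ qs (f ∘ act a) ≡ ∑ qs f) where

  state : Vec K n → Q → Point n → Q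
  state []      q []          = q
  state (a ∷ κ) q (false ∷ v) = state κ q v
  state (a ∷ κ) q (true ∷ v)  = state κ (act a q) v

  state-act : (κ : Vec K n) → ∀ a q v → state κ (act a q) v ≡ act a (state κ q v)
  state-act []      a q []          = refl
  state-act (b ∷ κ) a q (false ∷ v) = state-act κ a q v
  state-act (b ∷ κ) a q (true ∷ v)  = trans (cong (λ q → state κ q v) (act-comm b a q)) (state-act κ a (act b q) v)

  edge : K → Q → Q × Q
  edge a q = q , act a q

  -- Divided by `k ^ f * length qs`, this is the expectation of `Φ` over the classes of the flip
  -- coordinates and a uniform state at the corner of the subcube.
  R : ∀ f → (Cube Q f → ℤ) → ℤ
  R zero    Φ = ∑ qs Φ
  R (suc f) Φ = ∑ ks λ a → R f (Φ ∘ mapCube f (edge a))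

  count : ∀ f → (Cube Q f → ℕ) → ℕ
  count zero    Φ = total-count qs Φ
  count (suc f) Φ = total-count ks λ a → count f (Φ ∘ mapCube f (edge a))

  R≡count : ∀ f (Φ : Cube Q f → ℕ) → R f (λ x → + Φ x) ≡ + count f Φ
  R≡count zero    Φ = ∑≡total-count qs Φ
  R≡count (suc f) Φ = trans (∑-cong ks λ a → R≡count f (Φ ∘ mapCube f (edge a))) (∑≡total-count ks _)

  k : ℕ
  k = length ks

  open +-*-Solver using (solve; _:*_; _:=_)

  here? : ∀ f → Pattern n → ℤ
  here? f c = restrict f (λ _ → tt) (λ _ → 1ℤ) c

  sums : ∀ f → (Cube Q f → ℤ) → Pattern n → ℤ
  sums {n} f Φ c = ∑ (words ks n) λ κ → ∑ qs λ q → restrict f (state κ q) Φ c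

  -- A fixed coordinate contributes the factor `k`: its effect on the initial state is absorbed by
  -- `act-perm`. A flip coordinate contributes the sum over its class, which is one layer of `R`.
  -- The powers of `k` clear denominators.
  average : ∀ f (Φ : Cube Q f → ℤ) (c : Pattern n) → + (k ℕ.^ f) * sums f Φ c ≡ + (k ℕ.^ n) * (R f Φ * here? f c)
  average zero Φ [] = cong (+ 1 *_) (trans (trans (∑-∷ [] [] _) (trans (cong (_+_ (∑ qs Φ)) (∑-[] _)) (+-identityʳ _)))
    (sym (*-identityʳ (∑ qs Φ))))
  average (suc f) Φ [] = trans (cong (+ (k ℕ.^ suc f) *_) (trans (∑-cong (words ks 0) λ κ → ∑-zero qs) (∑-zero (words ks 0))))
    (trans (*-zeroʳ (+ (k ℕ.^ suc f))) (sym (trans (cong (+ 1 *_) (*-zeroʳ (R (suc f) Φ))) refl)))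
  average {suc n} f Φ (just b ∷ c) = begin
    + (k ℕ.^ f) * sums f Φ (just b ∷ c)                        ≡⟨ cong (+ (k ℕ.^ f) *_) (trans (∑-words ks _) (∑-cong (words ks n) λ κ →
                                                                    trans (∑-cong ks λ a → fixed f b κ a) (∑-const ks _))) ⟩
    + (k ℕ.^ f) * ∑ (words ks n) (λ κ → + k * ∑ qs λ q → restrict f (state κ q) Φ c)
                                                               ≡⟨ cong (+ (k ℕ.^ f) *_) (∑-*ˡ (words ks n) (+ k) _) ⟩
    + (k ℕ.^ f) * (+ k * sums f Φ c)                           ≡⟨ solve 3 (λ x y z → x :* (y :* z) := y :* (x :* z)) refl (+ (k ℕ.^ f)) (+ k) (sums f Φ c) ⟩
    + k * (+ (k ℕ.^ f) * sums f Φ c)                           ≡⟨ cong (+ k *_) (average f Φ c) ⟩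
    + k * (+ (k ℕ.^ n) * (R f Φ * here? f c))                  ≡⟨ sym (*-assoc (+ k) (+ (k ℕ.^ n)) _) ⟩
    + k * + (k ℕ.^ n) * (R f Φ * here? f c)                    ≡⟨ cong₂ (λ x y → x * (R f Φ * y)) (sym (pos-* k (k ℕ.^ n))) (skip f) ⟩
    + (k ℕ.^ suc n) * (R f Φ * here? f (just b ∷ c))           ∎
    where
    open ≡-Reasoning
    skip : ∀ f → here? f c ≡ here? f (just b ∷ c)
    skip zero    = refl
    skip (suc f) = refl
    fixed : ∀ f {Φ : Cube Q f → ℤ} b κ a → ∑ qs (λ q → restrict f (state (a ∷ κ) q) Φ (just b ∷ c)) ≡ ∑ qs λ q → restrict f (state κ q) Φ c
    fixed zero        false κ a = refl
    fixed (suc f)     false κ a = refl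
    fixed zero    {Φ} true  κ a = act-perm a λ q → restrict zero (state κ q) Φ c
    fixed (suc f) {Φ} true  κ a = act-perm a λ q → restrict (suc f) (state κ q) Φ c
  average {suc n} zero Φ (nothing ∷ c) = trans (cong (+ 1 *_) (trans (∑-cong (words ks (suc n)) λ κ → ∑-zero qs) (∑-zero (words ks (suc n)))))
    (sym (trans (cong (+ (k ℕ.^ suc n) *_) (*-zeroʳ (R zero Φ))) (*-zeroʳ (+ (k ℕ.^ suc n)))))
  average {suc n} (suc f) Φ (nothing ∷ c) = begin
    + (k ℕ.^ suc f) * sums (suc f) Φ (nothing ∷ c)             ≡⟨ cong (+ (k ℕ.^ suc f) *_) (trans (∑-words ks _) (trans (∑-swap (words ks n) ks _)
                                                                    (∑-cong ks λ a → ∑-cong (words ks n) λ κ → ∑-cong qs λ q → step a κ q))) ⟩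
    + (k ℕ.^ suc f) * ∑ ks (λ a → sums f (Φₐ a) c)             ≡⟨ cong (_* ∑ ks (λ a → sums f (Φₐ a) c)) (pos-* k (k ℕ.^ f)) ⟩
    + k * + (k ℕ.^ f) * ∑ ks (λ a → sums f (Φₐ a) c)           ≡⟨ *-assoc (+ k) (+ (k ℕ.^ f)) _ ⟩
    + k * (+ (k ℕ.^ f) * ∑ ks (λ a → sums f (Φₐ a) c))         ≡⟨ cong (+ k *_) (sym (∑-*ˡ ks (+ (k ℕ.^ f)) _)) ⟩
    + k * ∑ ks (λ a → + (k ℕ.^ f) * sums f (Φₐ a) c)           ≡⟨ cong (+ k *_) (∑-cong ks λ a → average f (Φₐ a) c) ⟩
    + k * ∑ ks (λ a → + (k ℕ.^ n) * (R f (Φₐ a) * here? f c))  ≡⟨ cong (+ k *_) (∑-*ˡ ks (+ (k ℕ.^ n)) _) ⟩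
    + k * (+ (k ℕ.^ n) * ∑ ks (λ a → R f (Φₐ a) * here? f c))  ≡⟨ cong (λ z → + k * (+ (k ℕ.^ n) * z)) (∑-*ʳ ks (here? f c) _) ⟩
    + k * (+ (k ℕ.^ n) * (R (suc f) Φ * here? f c))            ≡⟨ sym (*-assoc (+ k) (+ (k ℕ.^ n)) _) ⟩
    + k * + (k ℕ.^ n) * (R (suc f) Φ * here? f c)              ≡⟨ cong₂ (λ x y → x * (R (suc f) Φ * y)) (sym (pos-* k (k ℕ.^ n))) (restrict-1 f _ _ c) ⟩
    + (k ℕ.^ suc n) * (R (suc f) Φ * here? (suc f) (nothing ∷ c)) ∎
    where
    open ≡-Reasoning
    Φₐ : K → Cube Q f → ℤ
    Φₐ a = Φ ∘ mapCube f (edge a)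
    -- By commutativity the move of the first coordinate can be made last, so each pair of values
    -- has the form `edge a` of a state.
    step : ∀ a (κ : Vec K n) q → restrict (suc f) (state (a ∷ κ) q) Φ (nothing ∷ c) ≡ restrict f (state κ q) (Φₐ a) c
    step a κ q = trans (restrict-cong f (λ v → cong (state κ q v ,_) (state-act κ a q v)) Φ c) (restrict-map f (edge a) (state κ q) Φ c)

-- Needed because the maximum in `Λn` runs over listed configurations, which match a given one only
-- pointwise; the sum of `restrict` depends on values alone.
ΛS-cong : (H : Config 3) {S T : Config n} → (∀ v → S v ≡ T v) → ΛS H S ≡ ΛS H T
ΛS-cong {n} H {S} {T} e = +-injective (trans (ΛS≡∑restrict H (isCopy H) (λ _ → refl) S)
  (trans (∑-cong (allPatterns n) (restrict-cong 3 e (copies (isCopy H)))) (sym (ΛS≡∑restrict H (isCopy H) (λ _ → refl) T))))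

foldr-⊔-upper : {x : ℕ} {xs : List ℕ} → x ∈ xs → x ℕ.≤ foldr ℕ._⊔_ 0 xs
foldr-⊔-upper {xs = x ∷ xs} (here refl) = ℕ.m≤m⊔n x _
foldr-⊔-upper {xs = x ∷ xs} (there x∈)  = ℕ.≤-trans (foldr-⊔-upper x∈) (ℕ.m≤n⊔m x _)

foldr-⊔-ind : (P : ℕ → Set) (f : X → ℕ) (xs : List X) → P 0 → (∀ x → P (f x)) → P (foldr ℕ._⊔_ 0 (map f xs))
foldr-⊔-ind P f []       p₀ p = p₀
foldr-⊔-ind P f (x ∷ xs) p₀ p with ℕ.⊔-sel (f x) (foldr ℕ._⊔_ 0 (map f xs))
... | inj₁ e = subst P (sym e) (p x)
... | inj₂ e = subst P (sym e) (foldr-⊔-ind P f xs p₀ p)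

Λn-ind : ∀ {d} (H : Config d) (P : ℕ → Set) → P 0 → (∀ S → P (ΛS {n = n} H S)) → P (Λn H n)
Λn-ind {n} H P = foldr-⊔-ind P (ΛS H) (allConfigs n)

cancel-factor : ∀ r p q {x y} a b → x ≡ suc r ℕ.* p → y ≡ suc r ℕ.* q → x ℕ.* a ℕ.≤ y ℕ.* b → p ℕ.* a ℕ.≤ q ℕ.* b
cancel-factor r p q a b refl refl h = ℕ.*-cancelˡ-≤ (suc r) (subst₂ ℕ._≤_ (ℕ.*-assoc (suc r) p a) (ℕ.*-assoc (suc r) q b) h)

ΛS≤Λn : (H : Config 3) (S : Config n) → ΛS H S ℕ.≤ Λn H n
ΛS≤Λn {n} H S =
  let (T , T∈ , e) = allFuns-complete n (false ∷ true ∷ []) S (λ x → ∈-bools (S x))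
  in subst (ℕ._≤ Λn H n) (ΛS-cong H e) (foldr-⊔-upper (∈-map⁺ (ΛS H) T∈))
  where
  ∈-bools : ∀ b → b ∈ false ∷ true ∷ []
  ∈-bools false = here refl
  ∈-bools true  = there (here refl)

length-words : (xs : List X) → ∀ n → length (words xs n) ≡ length xs ℕ.^ n
length-words xs n = +-injective (trans (length≡∑ (words xs n)) (go n))
  where
  go : ∀ n → ∑ (words xs n) (λ _ → 1ℤ) ≡ + (length xs ℕ.^ n)
  go zero    = trans (∑-∷ [] [] _) (cong (_+_ 1ℤ) (∑-[] _))
  go (suc n) = trans (∑-words xs _) (trans (∑-cong (words xs n) λ w → trans (∑-const xs 1ℤ) (*-comm (+ length xs) 1ℤ))
    (trans (∑-*ʳ (words xs n) (+ length xs) (λ _ → 1ℤ)) (trans (cong (_* + length xs) (go n))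
      (trans (*-comm (+ (length xs ℕ.^ n)) (+ length xs)) (sym (pos-* (length xs) _))))))

module LowerBound {K Q : Set} (a₀ : K) (ks′ : List K) (qs : List Q) (act : K → Q → Q)
  (act-comm : ∀ a b q → act a (act b q) ≡ act b (act a q))
  (act-perm : ∀ a (f : Q → ℤ) → ∑ qs (f ∘ act a) ≡ ∑ qs f) (S₀ : Q → Bool)
  (H : Config 3) (p : Cube₃ → Bool) (isCopy≡ : ∀ x → isCopy H x ≡ p x) where

  open Averaging (a₀ ∷ ks′) qs act act-comm act-perm

  good : Cube Q 3 → ℕ
  good x = bit (p (mapCube 3 S₀ x))

  -- The maximum is at least the mean over all class assignments and initial states. Exchanging the
  -- sums gives every 3-subcube the same mean by `average`. The list of classes is nonempty, so
  -- `k ^ n` cancels.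
  lower : ∀ n → count 3 good ℕ.* ((n C 3) ℕ.* 2 ℕ.^ (n ℕ.∸ 3)) ℕ.≤ k ℕ.^ 3 ℕ.* (length qs ℕ.* Λn H n)
  lower n = drop‿+≤+ (*-cancelˡ-≤-pos _ _ (+ (k ℕ.^ n)) ⦃ positive (ℕ.m^n>0 k n) ⦄ chain)
    where
    open ≤-Reasoning
    N = (n C 3) ℕ.* 2 ℕ.^ (n ℕ.∸ 3)
    L = Λn H n
    positive : ∀ {m} → 0 ℕ.< m → Positive (+ m)
    positive (ℕ.s≤s _) = _
    summed : + (k ℕ.^ 3) * ∑ (words (a₀ ∷ ks′) n) (λ κ → ∑ qs λ q → + ΛS H (S₀ ∘ state κ q)) ≡ + (k ℕ.^ n) * + (count 3 good ℕ.* N)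
    summed = begin-equality
      + (k ℕ.^ 3) * ∑ (words (a₀ ∷ ks′) n) (λ κ → ∑ qs λ q → + ΛS H (S₀ ∘ state κ q))
        ≡⟨ cong (+ (k ℕ.^ 3) *_) (trans (∑-cong (words (a₀ ∷ ks′) n) λ κ → trans (∑-cong qs λ q → trans (ΛS≡∑restrict H p isCopy≡ (S₀ ∘ state κ q))
             (∑-cong (allPatterns n) λ c → restrict-map 3 S₀ (state κ q) (copies p) c)) (∑-swap qs (allPatterns n) _))
             (∑-swap (words (a₀ ∷ ks′) n) (allPatterns n) _)) ⟩
      + (k ℕ.^ 3) * ∑ (allPatterns n) (λ c → sums 3 (λ x → + good x) c)
        ≡⟨ sym (∑-*ˡ (allPatterns n) (+ (k ℕ.^ 3)) _) ⟩
      ∑ (allPatterns n) (λ c → + (k ℕ.^ 3) * sums 3 (λ x → + good x) c)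
        ≡⟨ ∑-cong (allPatterns n) (average 3 (λ x → + good x)) ⟩
      ∑ (allPatterns n) (λ c → + (k ℕ.^ n) * (R 3 (λ x → + good x) * here? 3 c))
        ≡⟨ trans (∑-*ˡ (allPatterns n) (+ (k ℕ.^ n)) _) (cong (+ (k ℕ.^ n) *_) (∑-*ˡ (allPatterns n) (R 3 (λ x → + good x)) (here? 3))) ⟩
      + (k ℕ.^ n) * (R 3 (λ x → + good x) * ∑ (allPatterns n) (here? 3))
        ≡⟨ cong (+ (k ℕ.^ n) *_) (trans (cong₂ _*_ (R≡count 3 good) (∑-restrict-1 3 n (λ _ → tt))) (sym (pos-* (count 3 good) N))) ⟩
      + (k ℕ.^ n) * + (count 3 good ℕ.* N) ∎
    chain : + (k ℕ.^ n) * + (count 3 good ℕ.* N) ≤ + (k ℕ.^ n) * + (k ℕ.^ 3 ℕ.* (length qs ℕ.* L))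
    chain = begin
      + (k ℕ.^ n) * + (count 3 good ℕ.* N)                    ≡⟨ sym summed ⟩
      + (k ℕ.^ 3) * ∑ (words (a₀ ∷ ks′) n) (λ κ → ∑ qs λ q → + ΛS H (S₀ ∘ state κ q))
        ≤⟨ *-monoˡ-≤-nonNeg (+ (k ℕ.^ 3)) (∑-mono (words (a₀ ∷ ks′) n) λ κ → ∑-mono qs λ q → +≤+ (ΛS≤Λn H (S₀ ∘ state κ q))) ⟩
      + (k ℕ.^ 3) * ∑ (words (a₀ ∷ ks′) n) (λ κ → ∑ qs λ q → + L)
        ≡⟨ cong (+ (k ℕ.^ 3) *_) (trans (∑-cong (words (a₀ ∷ ks′) n) λ κ → trans (∑-const qs (+ L)) (sym (pos-* (length qs) L)))
             (trans (∑-const (words (a₀ ∷ ks′) n) _) (cong (λ m → + m * + (length qs ℕ.* L)) (length-words (a₀ ∷ ks′) n)))) ⟩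
      + (k ℕ.^ 3) * (+ (k ℕ.^ n) * + (length qs ℕ.* L))
        ≡⟨ solve 3 (λ x y z → x :* (y :* z) := y :* (x :* z)) refl (+ (k ℕ.^ 3)) (+ (k ℕ.^ n)) (+ (length qs ℕ.* L)) ⟩
      + (k ℕ.^ n) * (+ (k ℕ.^ 3) * + (length qs ℕ.* L))       ≡⟨ cong (+ (k ℕ.^ n) *_) (sym (pos-* (k ℕ.^ 3) _)) ⟩
      + (k ℕ.^ n) * + (k ℕ.^ 3 ℕ.* (length qs ℕ.* L))         ∎
      where open +-*-Solver using (solve; _:*_; _:=_)

  lower-ratio : ∀ r p q → count 3 good ≡ suc r ℕ.* p → k ℕ.^ 3 ℕ.* length qs ≡ suc r ℕ.* q →
                ∀ n → p ℕ.* ((n C 3) ℕ.* 2 ℕ.^ (n ℕ.∸ 3)) ℕ.≤ q ℕ.* Λn H n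
  lower-ratio r p q e₁ e₂ n = cancel-factor r p q ((n C 3) ℕ.* 2 ℕ.^ (n ℕ.∸ 3)) (Λn H n) e₁ e₂
    (subst (count 3 good ℕ.* ((n C 3) ℕ.* 2 ℕ.^ (n ℕ.∸ 3)) ℕ.≤_) (sym (ℕ.*-assoc (k ℕ.^ 3) (length qs) (Λn H n))) (lower n))

-- Upper bound for the maximum, and cyclic actions

module _ (F : Maybe (ℕ → Form)) (G : Maybe Form) (H : Config 3) (p : Cube₃ → Bool) (isCopy≡ : ∀ x → isCopy H x ≡ p x)
  (p-symmetric : Symmetric p) (den num : ℕ) (checked : Certificate.check F G p den num (Certificate.tables F G p den num) ≡ true) where

  ΛS-upper : ∀ m (S : Config (suc m)) → den ℕ.* (48 ℕ.* ΛS H S) ℕ.≤ num ℕ.* (2 ℕ.^ suc m ℕ.* (suc m ℕ.* (suc m ℕ.* suc m)))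
  ΛS-upper m S = drop‿+≤+ (begin
    + (den ℕ.* (48 ℕ.* ΛS H S))                                 ≡⟨ trans (pos-* den (48 ℕ.* ΛS H S)) (cong (+ den *_) (pos-* 48 (ΛS H S))) ⟩
    + den * (+ 48 * + ΛS H S)                                   ≡⟨ cong (λ z → + den * (+ 48 * z)) (ΛS≡∑restrict H p isCopy≡ S) ⟩
    + den * (+ 48 * ∑ (allPatterns (suc m)) (restrict 3 S (copies p)))
      ≤⟨ *-monoˡ-≤-nonNeg (+ den) (DoubleCount.48*∑restrict≤E₃ p p-symmetric S) ⟩
    + den * Multiples.E₃ S (copies p)                           ≤⟨ Bound.E-copies≤ F G p den num p-symmetric checked S ⟩
    + num * Multiples.E₃ S (λ _ → 1ℤ)                           ≡⟨ trans (cong (+ num *_) (E₃-1 S)) (sym (pos-* num _)) ⟩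
    + (num ℕ.* (2 ℕ.^ suc m ℕ.* (suc m ℕ.* (suc m ℕ.* suc m)))) ∎)
    where open ≤-Reasoning

  Λn-upper : ∀ m → den ℕ.* (48 ℕ.* Λn H (suc m)) ℕ.≤ num ℕ.* (2 ℕ.^ suc m ℕ.* (suc m ℕ.* (suc m ℕ.* suc m)))
  Λn-upper m = Λn-ind H (λ x → den ℕ.* (48 ℕ.* x) ℕ.≤ num ℕ.* (2 ℕ.^ suc m ℕ.* (suc m ℕ.* (suc m ℕ.* suc m))))
    (subst (ℕ._≤ num ℕ.* (2 ℕ.^ suc m ℕ.* (suc m ℕ.* (suc m ℕ.* suc m)))) (sym (ℕ.*-zeroʳ den)) ℕ.z≤n) (ΛS-upper m)

  upper-ratio : ∀ r p q → den ≡ suc r ℕ.* q → num ≡ suc r ℕ.* p →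
                ∀ m → q ℕ.* (48 ℕ.* Λn H (suc m)) ℕ.≤ p ℕ.* (2 ℕ.^ suc m ℕ.* (suc m ℕ.* (suc m ℕ.* suc m)))
  upper-ratio r p q e₁ e₂ m =
    cancel-factor r q p (48 ℕ.* Λn H (suc m)) (2 ℕ.^ suc m ℕ.* (suc m ℕ.* (suc m ℕ.* suc m))) e₁ e₂ (Λn-upper m)

iterate : ∀ {A : Set} → (A → A) → ℕ → A → A
iterate f zero    x = x
iterate f (suc k) x = f (iterate f k x)

iterate-comm : ∀ {A : Set} (f : A → A) j k x → iterate f j (iterate f k x) ≡ iterate f k (iterate f j x)
iterate-comm f zero    k x = refl
iterate-comm f (suc j) k x = trans (cong f (iterate-comm f j k x)) (step k (iterate f j x))
  where
  step : ∀ k x → f (iterate f k x) ≡ iterate f k (f x)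
  step zero    x = refl
  step (suc k) x = cong f (step k x)

module Cyclic (m : ℕ) where

  rotate : ℕ → ℕ
  rotate q = if suc q ≡ᵇ suc m then 0 else suc q

  states : List ℕ
  states = upTo (suc m)

  module _ (rotates : map rotate states ≡ map suc (upTo m) ++ 0 ∷ []) (starts : states ≡ 0 ∷ map suc (upTo m)) where

    rotate-perm : ∀ f → ∑ states (f ∘ rotate) ≡ ∑ states f
    rotate-perm f = trans (sym (∑-map rotate states f)) (trans (cong (λ xs → ∑ xs f) rotates)
      (trans (∑-++ (map suc (upTo m)) (0 ∷ []) f) (trans (+-comm (∑ (map suc (upTo m)) f) _)
        (trans (cong (_+ ∑ (map suc (upTo m)) f) (trans (∑-∷ 0 [] f) (trans (cong (_+_ (f 0)) (∑-[] f)) (+-identityʳ (f 0)))))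
          (trans (sym (∑-∷ 0 (map suc (upTo m)) f)) (cong (λ xs → ∑ xs f) (sym starts)))))))

    iterate-perm : ∀ k f → ∑ states (f ∘ iterate rotate k) ≡ ∑ states f
    iterate-perm zero    f = refl
    iterate-perm (suc k) f = trans (iterate-perm k (f ∘ rotate)) (rotate-perm f)


orbit : List ℕ → Cube₃ → Bool
orbit codes x = any (_≡ᵇ rank x) codes

isCopy≡orbit : ∀ H codes → all₃ (λ x → boolEq (isCopy H x) (orbit codes x)) ≡ true → ∀ x → isCopy H x ≡ orbit codes x
isCopy≡orbit H codes e x = boolEq-sound (all₃-sound (λ x → boolEq (isCopy H x) (orbit codes x)) e x)

-- The five configurations

-- The certificates were found by semidefinite programming and rounded.  The argument of faces9 and faces10 is the code of
-- the base face; in the vertices vectors, even codes belong to vertices outside S and odd codes to vertices in S.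

module C₃ = Cyclic 2
module C₄ = Cyclic 3

-- Mean zero on the weights 1 modulo 3: at a typical vertex outside that set half of the directions
-- lead into it, so codes 6 and 8 have frequency about 1/4 each, codes 2 and 4 together 1/2, and 2 -
-- 4 + 2 · 1 = 0.
vertices7 : Form
vertices7 = (1 , (2 , + 1) ∷ (4 , + 1) ∷ (6 , + 2) ∷ (8 , -[1+ 3 ]) ∷ (10 , + 1) ∷ (12 , + 1) ∷ (14 , + 2) ∷ []) ∷ []

orbit7 : Cube₃ → Bool
orbit7 = orbit (24 ∷ 36 ∷ 66 ∷ 129 ∷ [])

isCopy7 : ∀ x → isCopy W7 x ≡ orbit7 x
isCopy7 = isCopy≡orbit W7 (24 ∷ 36 ∷ 66 ∷ 129 ∷ []) refl

-- The four layers of a subcube have states q, q + 1, q + 2, q; the set meets it in an antipodal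
-- pair exactly for q = 1.
lower7 : ∀ n → 1 ℕ.* subcubeCount n ℕ.≤ 3 ℕ.* Λn W7 n
lower7 = LowerBound.lower-ratio 1 [] C₃.states (iterate C₃.rotate) (iterate-comm C₃.rotate) (C₃.iterate-perm refl refl) (_≡ᵇ 1)
  W7 orbit7 isCopy7 0 1 3 refl refl

checked7 : Certificate.check nothing (just vertices7) orbit7 9 3 (Certificate.tables nothing (just vertices7) orbit7 9 3) ≡ true
checked7 = refl

inducibility7 : Inducibility W7 (frac 1 3)
inducibility7 = inducibility W7 1 2 (≤ᵇ-sound refl) lower7
  (upper-ratio nothing (just vertices7) W7 orbit7 isCopy7 (symmetric-sound orbit7 refl) 9 3 checked7 2 1 3 refl refl)

-- With the same code frequencies as for `vertices7`, the mean is zero because -2 + 2 · 1 = 0.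
vertices8 : Form
vertices8 = (1 , (2 , + 1) ∷ (4 , + 1) ∷ (6 , -[1+ 1 ]) ∷ (10 , + 1) ∷ (12 , + 1) ∷ (14 , -[1+ 1 ]) ∷ []) ∷ []

orbit8 : Cube₃ → Bool
orbit8 = orbit (22 ∷ 41 ∷ 73 ∷ 97 ∷ 104 ∷ 134 ∷ 146 ∷ 148 ∷ [])

isCopy8 : ∀ x → isCopy W8 x ≡ orbit8 x
isCopy8 = isCopy≡orbit W8 (22 ∷ 41 ∷ 73 ∷ 97 ∷ 104 ∷ 134 ∷ 146 ∷ 148 ∷ []) refl

-- The same set as for W7: the initial states 0 and 2 leave exactly the layer of weight 1 or of
-- weight 2, both copies of W8.
lower8 : ∀ n → 2 ℕ.* subcubeCount n ℕ.≤ 3 ℕ.* Λn W8 n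
lower8 = LowerBound.lower-ratio 1 [] C₃.states (iterate C₃.rotate) (iterate-comm C₃.rotate) (C₃.iterate-perm refl refl) (_≡ᵇ 1)
  W8 orbit8 isCopy8 0 2 3 refl refl

checked8 : Certificate.check nothing (just vertices8) orbit8 3 2 (Certificate.tables nothing (just vertices8) orbit8 3 2) ≡ true
checked8 = refl

inducibility8 : Inducibility W8 (frac 2 3)
inducibility8 = inducibility W8 2 2 (≤ᵇ-sound refl) lower8
  (upper-ratio nothing (just vertices8) W8 orbit8 isCopy8 (symmetric-sound orbit8 refl) 3 2 checked8 0 2 3 refl refl)

-- Since base points are summed over, at most one code per translation orbit of the base face
-- carries forms. Transposing a face exchanges codes 2 and 4, 3 and 5, 10 and 12, 11 and 13, and it
-- exchanges the forms at 3 and 5.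
faces9 : ℕ → Form
faces9 1 = (16 , (1 , + 1) ∷ (2 , + 1) ∷ (3 , + 1) ∷ (4 , + 1) ∷ (5 , + 1) ∷ (7 , + 1) ∷ (8 , + 1) ∷ (9 , + 2) ∷ (14 , -[1+ 1 ]) ∷ []) ∷ []
faces9 3 = (8 , (0 , + 1) ∷ (5 , -1ℤ) ∷ (6 , -1ℤ) ∷ (9 , -1ℤ) ∷ (10 , -1ℤ) ∷ (12 , + 2) ∷ (15 , + 1) ∷ []) ∷ []
faces9 5 = (8 , (0 , + 1) ∷ (3 , -1ℤ) ∷ (6 , -1ℤ) ∷ (9 , -1ℤ) ∷ (10 , + 2) ∷ (12 , -1ℤ) ∷ (15 , + 1) ∷ []) ∷ []
faces9 6 = (2 , (3 , + 1) ∷ (5 , + 1) ∷ (6 , + 4) ∷ (9 , -[1+ 1 ]) ∷ (10 , + 1) ∷ (12 , + 1) ∷ []) ∷ []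
faces9 7 = (16 , (1 , + 1) ∷ (3 , + 1) ∷ (5 , + 1) ∷ (6 , + 2) ∷ (7 , + 1) ∷ (8 , -[1+ 1 ]) ∷ (11 , + 1) ∷ (13 , + 1) ∷ (14 , + 1) ∷ []) ∷ []
faces9 _ = []

orbit9 : Cube₃ → Bool
orbit9 = orbit (30 ∷ 45 ∷ 54 ∷ 57 ∷ 75 ∷ 86 ∷ 89 ∷ 99 ∷ 101 ∷ 106 ∷ 108 ∷ 120 ∷ 135 ∷ 147 ∷ 149 ∷ 154 ∷ 156 ∷ 166 ∷ 169 ∷ 180 ∷ 198 ∷ 201 ∷ 210 ∷ 225 ∷ [])

isCopy9 : ∀ x → isCopy W9 x ≡ orbit9 x
isCopy9 = isCopy≡orbit W9 (30 ∷ 45 ∷ 54 ∷ 57 ∷ 75 ∷ 86 ∷ 89 ∷ 99 ∷ 101 ∷ 106 ∷ 108 ∷ 120 ∷ 135 ∷ 147 ∷ 149 ∷ 154 ∷ 156 ∷ 166 ∷ 169 ∷ 180 ∷ 198 ∷ 201 ∷ 210 ∷ 225 ∷ []) refl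

-- The copies are the subcubes with exactly one flip coordinate of step 2, whatever the initial
-- state: 3 · (1/3) · (2/3)² = 4/9.
lower9 : ∀ n → 4 ℕ.* subcubeCount n ℕ.≤ 9 ℕ.* Λn W9 n
lower9 = LowerBound.lower-ratio 1 (1 ∷ 2 ∷ []) C₄.states (iterate C₄.rotate) (iterate-comm C₄.rotate) (C₄.iterate-perm refl refl) (_<ᵇ 2)
  W9 orbit9 isCopy9 11 4 9 refl refl

checked9 : Certificate.check (just faces9) nothing orbit9 9 4 (Certificate.tables (just faces9) nothing orbit9 9 4) ≡ true
checked9 = refl

inducibility9 : Inducibility W9 (frac 4 9)
inducibility9 = inducibility W9 4 8 (≤ᵇ-sound refl) lower9
  (upper-ratio (just faces9) nothing W9 orbit9 isCopy9 (symmetric-sound orbit9 refl) 9 4 checked9 0 4 9 refl refl)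

byte : (a b c d e f g h : Bool) → Cube₃
byte a b c d e f g h = ((a , b) , (c , d)) , ((e , f) , (g , h))

-- Found by computer search: three quarters of the 3-subcubes in any three directions are copies of W10.
seed : Cube Bool 6
seed = ((byte l o o o o l o l , byte o l l o o o l o) , (byte o o l l l o o o , byte o l o o l o o l)) ,
       ((byte l o o l o o l o , byte o o o l l l o o) , (byte o l o o o l l o , byte l o l o o o o l))

faces10 : ℕ → Form
faces10 0 = (240 , (1 , + 1) ∷ (8 , -1ℤ) ∷ [])
  ∷ (84 , (6 , -1ℤ) ∷ (9 , -1ℤ) ∷ (15 , + 4) ∷ []) ∷ []
faces10 1 = (309 , (2 , + 1) ∷ (4 , -1ℤ) ∷ (10 , -1ℤ) ∷ (12 , + 1) ∷ [])
  ∷ (97 , (2 , + 1) ∷ (4 , -1ℤ) ∷ [])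
  ∷ (27 , (10 , + 1) ∷ (12 , -1ℤ) ∷ [])
  ∷ (68 , (6 , + 1) ∷ (9 , -[1+ 4 ]) ∷ (10 , + 2) ∷ (12 , + 2) ∷ [])
  ∷ (16 , (2 , + 1) ∷ (4 , + 1) ∷ (6 , + 2) ∷ (9 , -[1+ 3 ]) ∷ [])
  ∷ (42 , (2 , + 1) ∷ (4 , + 1) ∷ (9 , -[1+ 1 ]) ∷ []) ∷ []
faces10 3 = (23 , (3 , -[1+ 1 ]) ∷ (4 , + 1) ∷ (8 , + 1) ∷ (12 , -[1+ 1 ]) ∷ [])
  ∷ (18 , (3 , + 4) ∷ (4 , -1ℤ) ∷ (8 , -1ℤ) ∷ [])
  ∷ (260 , (3 , + 1) ∷ (12 , -1ℤ) ∷ []) ∷ []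
faces10 5 = (23 , (2 , + 1) ∷ (5 , -[1+ 1 ]) ∷ (8 , + 1) ∷ (10 , -[1+ 1 ]) ∷ [])
  ∷ (18 , (2 , -1ℤ) ∷ (5 , + 4) ∷ (8 , -1ℤ) ∷ [])
  ∷ (260 , (5 , + 1) ∷ (10 , -1ℤ) ∷ []) ∷ []
faces10 6 = (194 , (1 , + 1) ∷ (8 , -1ℤ) ∷ []) ∷ []
faces10 _ = []

vertices10 : Form
vertices10 = (8 , (0 , + 5) ∷ (6 , -[1+ 6 ]) ∷ (8 , + 13) ∷ (10 , -[1+ 4 ]) ∷ (12 , -[1+ 4 ]) ∷ (14 , -[1+ 2 ]) ∷ [])
  ∷ (8 , (1 , -[1+ 5 ]) ∷ (3 , + 7) ∷ (5 , + 7) ∷ (7 , + 2) ∷ (9 , -1ℤ) ∷ (11 , -[1+ 1 ]) ∷ (13 , -[1+ 1 ]) ∷ (15 , + 5) ∷ []) ∷ []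

orbit10 : Cube₃ → Bool
orbit10 = orbit (25 ∷ 26 ∷ 28 ∷ 37 ∷ 38 ∷ 44 ∷ 52 ∷ 56 ∷ 67 ∷ 70 ∷ 74 ∷ 82 ∷ 88 ∷ 98 ∷ 100 ∷ 131 ∷ 133 ∷ 137 ∷ 145 ∷ 152 ∷ 161 ∷ 164 ∷ 193 ∷ 194 ∷ [])

isCopy10 : ∀ x → isCopy W10 x ≡ orbit10 x
isCopy10 = isCopy≡orbit W10 (25 ∷ 26 ∷ 28 ∷ 37 ∷ 38 ∷ 44 ∷ 52 ∷ 56 ∷ 67 ∷ 70 ∷ 74 ∷ 82 ∷ 88 ∷ 98 ∷ 100 ∷ 131 ∷ 133 ∷ 137 ∷ 145 ∷ 152 ∷ 161 ∷ 164 ∷ 193 ∷ 194 ∷ []) refl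

-- Three classes are distinct with probability 5/9, and then 3/4 of the states give a copy: 5/12 in
-- total. A repeated class makes the number of points even, so W10 cannot occur. The counts are 5760
-- = 1152 · 5 and 6³ · 64 = 1152 · 12.
lower10 : ∀ n → 5 ℕ.* subcubeCount n ℕ.≤ 12 ℕ.* Λn W10 n
lower10 = LowerBound.lower-ratio zero (map suc (allFin 5)) (allPoints 6) flip flip-comm ∑-flip (at {k = 6} seed)
  W10 orbit10 isCopy10 1151 5 12 refl refl

-- 480 and 200 are 12 and 5 times 40, the scale at which the weights of the squares are integers.
checked10 : Certificate.check (just faces10) (just vertices10) orbit10 480 200 (Certificate.tables (just faces10) (just vertices10) orbit10 480 200) ≡ true
checked10 = refl

inducibility10 : Inducibility W10 (frac 5 12)
inducibility10 = inducibility W10 5 11 (≤ᵇ-sound refl) lower10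
  (upper-ratio (just faces10) (just vertices10) W10 orbit10 isCopy10 (symmetric-sound orbit10 refl) 480 200 checked10 39 5 12 refl refl)

orbit12 : Cube₃ → Bool
orbit12 = orbit (23 ∷ 43 ∷ 77 ∷ 113 ∷ 142 ∷ 178 ∷ 212 ∷ 232 ∷ [])

isCopy12 : ∀ x → isCopy W12 x ≡ orbit12 x
isCopy12 = isCopy≡orbit W12 (23 ∷ 43 ∷ 77 ∷ 113 ∷ 142 ∷ 178 ∷ 212 ∷ 232 ∷ []) refl

-- From the initial state 0 the layers 0 and 1 lie in the set, from state 2 the layers 2 and 3: a
-- vertex with its neighbours in two of four cases.
lower12 : ∀ n → 1 ℕ.* subcubeCount n ℕ.≤ 2 ℕ.* Λn W12 n
lower12 = LowerBound.lower-ratio 1 [] C₄.states (iterate C₄.rotate) (iterate-comm C₄.rotate) (C₄.iterate-perm refl refl) (_<ᵇ 2)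
  W12 orbit12 isCopy12 1 1 2 refl refl

-- Here the pointwise count alone is sharp: at most four of the eight 3-faces of a 4-cube are
-- copies.
checked12 : Certificate.check nothing nothing orbit12 2 1 (Certificate.tables nothing nothing orbit12 2 1) ≡ true
checked12 = refl

inducibility12 : Inducibility W12 (frac 1 2)
inducibility12 = inducibility W12 1 1 (≤ᵇ-sound refl) lower12
  (upper-ratio nothing nothing W12 orbit12 isCopy12 (symmetric-sound orbit12 refl) 2 1 checked12 0 1 2 refl refl)

theorem1p1 : Inducibility W7 (frac 1 3) × Inducibility W8 (frac 2 3)
    × Inducibility W9 (frac 4 9) × Inducibility W10 (frac 5 12)
    × Inducibility W12 (frac 1 2)
theorem1p1 = inducibility7 , inducibility8 , inducibility9 , inducibility10 , inducibility12
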